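{- There exists $n_0$ such that for every integer $n \ge n_0$ we have $M(n,n-1) \ge n^{1.0797}$.
   Context: For permutations $\sigma,\tau$ of $[n]=\{1,\dots,n\}$, the Hamming distance $d(\sigma,\tau)$ is the number of $x\in[n]$ with $\sigma(x)\neq\tau(x)$. A permutation code PC$(n,d)$ is a subset $\Gamma$ of the symmetric group $\mathcal{S}_n$ such that any two distinct elements of $\Gamma$ are at Hamming distance at least $d$. $M(n,d)$ denotes the maximum size of a PC$(n,d)$. -}

module Defs where

open import Data.Nat using (ℕ; _≥_)
open import Data.Fin using (Fin; _≟_)
open import Data.Fin.Permutation using (Permutation′; _⟨$⟩ʳ_; _≈_)
open import Data.List using (List; length; filter; allFin; lookup)
open import Relation.Nullary using (¬_; ¬?)
open import Relation.Binary.PropositionalEquality using (_≡_)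

hamming : {n : ℕ} → Permutation′ n → Permutation′ n → ℕ
hamming {n} σ τ = length (filter (λ x → ¬? ((σ ⟨$⟩ʳ x) ≟ (τ ⟨$⟩ʳ x))) (allFin n))

IsPermCode : (n d : ℕ) → List (Permutation′ n) → Set
IsPermCode n d Γ =
  (i j : Fin (length Γ)) → ¬ (i ≡ j) →
    ¬ (lookup Γ i ≈ lookup Γ j) × hamming (lookup Γ i) (lookup Γ j) ≥ d
  where open import Data.Product using (_×_)

-- "M(n,d) ≥ m": some PC(n,d) has at least m elements
-- (M(n,d) is the maximum size of a PC(n,d)).
M≥ : (n d m : ℕ) → Set
M≥ n d m = Σ (List (Permutation′ n)) λ Γ → IsPermCode n d Γ × length Γ ≥ m
  where open import Data.Product using (Σ; _×_)

{-# OPTIONS --safe #-}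
-- Suppose n = m + k where m has no prime factor below s.  The lines y = a x + b over ℤ/m with
-- slopes a in an interval of length less than s pairwise meet in at most one point.  Each line is
-- made into a permutation of m + k points by giving up k of its cells (x, y): position x takes a
-- new symbol and a new position takes the symbol y.  Lines of different slope give up cells in
-- disjoint ranges of rows and columns, and for parallel lines the cells are arranged along
-- arithmetic progressions so that two of them collide at most once.  This works for about m lines
-- per slope as long as k s³ is of order at most m, and gives about n s permutations.
--
-- A suitable m with n − k ≤ m ≤ n is found by the Brun–Hooley sieve.  The primes below s = 2^K are
-- cut into blocks [2^I, 2^(2I)); Chebyshev's bound for binomial coefficients gives a sum of
-- reciprocals close to 2 log 2 in each block, and an interval of length about s^(37/4) suffices.
-- Since 37/4 + 3 = 12.25, s may be nearly n^(1/12.25), and 1/12.25 > 0.0797.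
module Submission where

open import Defs
open import Data.Nat using (ℕ; _≥_; _∸_; _^_)
import Data.Nat.Properties as ℕ
open import Data.Product using (Σ; _×_)

-- A prime m would make every slope usable, but k would then be the distance to a prime, and good
-- bounds for that are deep. Only slopes and their differences have to be cancelled modulo m, and
-- these lie below s, so it is enough that m has no prime factor below s; an elementary sieve finds
-- such m in short intervals. The two halves compete: a larger s lengthens both the progressions of
-- cells that are given up and the interval that the sieve needs.
--
-- The exponent is spent as follows, in units of K = log₂ s. The monomials of the upper-bound sieve
-- cost 33/4; the correction that turns it into a lower bound costs one more prime factor, hence the
-- 37/4. The smallest primes and all constants are allowed 1/8 more, so log n must be about 75/8 + 3
-- = 99/8 times log s. Since K has to be w · 2^t with w bounded, it is rounded to eight binary
-- digits; this loses a factor of at most 129/128 and leads to 25/2. Finally 2/25 = 0.08 exceeds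
-- 0.0797.

module RoughNumbers where

  open import Data.Nat as ℕ using (ℕ; zero; suc; _!)
  import Data.Nat.Properties as ℕ
  open import Data.Nat.Combinatorics using (_C_; nCk≡n!/k![n-k]!; k![n∸k]!∣n!; nCk+nC[k+1]≡[n+1]C[k+1])
  open import Data.Nat.DivMod using (m/n*n≡m)
  open import Data.Nat.Divisibility using (_∣_; _∤_; _∣?_; divides; ∣-trans; m∣m*n; n∣m*n; ∣⇒≤; m≤n⇒m!∣n!; *-monoʳ-∣; ∣1⇒≡1; 1∣_)
  open import Data.Nat.ListAction using (product)
  open import Data.Nat.Primality using (Prime; prime?; euclidsLemma; prime⇒nonZero; prime⇒nonTrivial; prime⇒irreducible; ¬prime[1])
  open import Data.Nat.Tactic.RingSolver using (solve-∀)
  import Data.Integer as ℤ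
  open import Data.Rational as ℚ using (ℚ; 0ℚ; 1ℚ; ½; _+_; _*_; _-_; -_; _≤_; _<_; _/_; 1/_; _<?_; nonNegative; positive)
  open import Data.Rational.Properties hiding (_<?_)
  open import Data.Rational.Solver using (module +-*-Solver)
  open +-*-Solver using (solve; _:=_; _:+_; _:*_; _:-_; :-_; con)
  open import Data.List using (List; []; _∷_; _++_; map; length)
  open import Data.List.Properties using (map-++; length-++)
  open import Data.List.Membership.Propositional using (_∈_)
  open import Data.List.Membership.Propositional.Properties using (∈-++⁺ˡ; ∈-++⁺ʳ)
  open import Data.List.Relation.Unary.All as All using (All; []; _∷_)
  import Data.List.Relation.Unary.All.Properties as All
  open import Data.List.Relation.Unary.AllPairs as AllPairs using (AllPairs; []; _∷_)
  import Data.List.Relation.Unary.AllPairs.Properties as AllPairs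
  open import Data.List.Relation.Unary.Any using (here; there)
  open import Data.Product using (_×_; _,_; proj₁; proj₂; ∃-syntax)
  open import Data.Sum using (inj₁; inj₂)
  open import Data.Unit using (⊤; tt)
  open import Relation.Nullary using (Dec; yes; no; ¬_; contradiction)
  open import Relation.Nullary.Decidable using (toWitness)
  open import Relation.Binary.PropositionalEquality using (_≡_; _≢_; refl; sym; trans; cong; cong₂; subst; module ≡-Reasoning)

  -- Ordered arithmetic in the rationals.

  0≤1 : 0ℚ ≤ 1ℚ
  0≤1 = nonNegative⁻¹ 1ℚ

  0<1 : 0ℚ < 1ℚ
  0<1 = positive⁻¹ 1ℚ

  diff-≥0⇒≤ : ∀ {p q r} → q - p ≡ r → 0ℚ ≤ r → p ≤ q
  diff-≥0⇒≤ {p} {q} {r} eq 0≤r = begin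
    p            ≡⟨ sym (+-identityʳ p) ⟩
    p + 0ℚ       ≤⟨ +-monoʳ-≤ p 0≤r ⟩
    p + r        ≡⟨ cong (p +_) (sym eq) ⟩
    p + (q - p)  ≡⟨ solve 2 (λ x y → x :+ (y :- x) := y) refl p q ⟩
    q            ∎
    where open ≤-Reasoning

  ≤⇒0≤diff : ∀ {p q} → p ≤ q → 0ℚ ≤ q - p
  ≤⇒0≤diff {p} {q} p≤q = begin
    0ℚ     ≡⟨ sym (+-inverseʳ p) ⟩
    p - p  ≤⟨ +-monoˡ-≤ (- p) p≤q ⟩
    q - p  ∎
    where open ≤-Reasoning

  *-monoˡ : ∀ {r p q} → 0ℚ ≤ r → p ≤ q → r * p ≤ r * q
  *-monoˡ {r} 0≤r = *-monoˡ-≤-nonNeg r {{nonNegative 0≤r}}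

  *-monoʳ : ∀ {r p q} → 0ℚ ≤ r → p ≤ q → p * r ≤ q * r
  *-monoʳ {r} 0≤r = *-monoʳ-≤-nonNeg r {{nonNegative 0≤r}}

  0≤* : ∀ {p q} → 0ℚ ≤ p → 0ℚ ≤ q → 0ℚ ≤ p * q
  0≤* {p} {q} 0≤p 0≤q = subst (_≤ p * q) (*-zeroʳ p) (*-monoˡ 0≤p 0≤q)

  0≤+ : ∀ {p q} → 0ℚ ≤ p → 0ℚ ≤ q → 0ℚ ≤ p + q
  0≤+ 0≤p 0≤q = +-mono-≤ 0≤p 0≤q

  *-mono : ∀ {p q r s} → 0ℚ ≤ p → 0ℚ ≤ s → p ≤ q → r ≤ s → p * r ≤ q * s
  *-mono 0≤p 0≤s p≤q r≤s = ≤-trans (*-monoˡ 0≤p r≤s) (*-monoʳ 0≤s p≤q)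

  *-cancelˡ : ∀ {r p q} → 0ℚ < r → r * p ≤ r * q → p ≤ q
  *-cancelˡ {r} 0<r = *-cancelˡ-≤-pos r {{positive 0<r}}

  ι : ℕ → ℚ
  ι zero    = 0ℚ
  ι (suc n) = 1ℚ + ι n

  0≤ι : ∀ n → 0ℚ ≤ ι n
  0≤ι zero    = ≤-refl
  0≤ι (suc n) = 0≤+ 0≤1 (0≤ι n)

  0<ι : ∀ n → 0ℚ < ι (suc n)
  0<ι n = <-≤-trans 0<1 (subst (_≤ ι (suc n)) (+-identityʳ 1ℚ) (+-monoʳ-≤ 1ℚ (0≤ι n)))

  ι-mono : ∀ {m n} → m ℕ.≤ n → ι m ≤ ι n
  ι-mono {n = n} ℕ.z≤n = 0≤ι n
  ι-mono (ℕ.s≤s m≤n)   = +-monoʳ-≤ 1ℚ (ι-mono m≤n)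

  ι-+ : ∀ m n → ι (m ℕ.+ n) ≡ ι m + ι n
  ι-+ zero    n = sym (+-identityˡ (ι n))
  ι-+ (suc m) n = trans (cong (1ℚ +_) (ι-+ m n)) (sym (+-assoc 1ℚ (ι m) (ι n)))

  ι-* : ∀ m n → ι (m ℕ.* n) ≡ ι m * ι n
  ι-* zero    n = sym (*-zeroˡ (ι n))
  ι-* (suc m) n = begin
    ι (n ℕ.+ m ℕ.* n)   ≡⟨ ι-+ n (m ℕ.* n) ⟩
    ι n + ι (m ℕ.* n)   ≡⟨ cong (ι n +_) (ι-* m n) ⟩
    ι n + ι m * ι n     ≡⟨ solve 2 (λ x y → y :+ x :* y := (con 1ℚ :+ x) :* y) refl (ι m) (ι n) ⟩
    (1ℚ + ι m) * ι n    ∎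
    where open ≡-Reasoning

  -- The value 0 at 0 makes `Unit (recip n)` true for every n, so that `recip` is a legitimate
  -- system of weights without side conditions.
  recip : ℕ → ℚ
  recip zero    = 0ℚ
  recip (suc n) = (1/ ι (suc n)) {{pos⇒nonZero (ι (suc n)) {{positive (0<ι n)}}}}

  ι*recip : ∀ n → ι (suc n) * recip (suc n) ≡ 1ℚ
  ι*recip n = *-inverseʳ (ι (suc n)) {{pos⇒nonZero (ι (suc n)) {{positive (0<ι n)}}}}

  0≤recip : ∀ n → 0ℚ ≤ recip n
  0≤recip zero    = ≤-refl
  0≤recip (suc n) = *-cancelˡ (0<ι n)
    (subst (_≤ ι (suc n) * recip (suc n)) (sym (*-zeroʳ (ι (suc n)))) (subst (0ℚ ≤_) (sym (ι*recip n)) 0≤1))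

  -- Bonferroni inequalities and symmetric sums.

  altSum : ℕ → List ℚ → ℚ
  altSum zero    xs       = 1ℚ
  altSum (suc b) []       = 1ℚ
  altSum (suc b) (x ∷ xs) = altSum (suc b) xs - x * altSum b xs

  esym : ℕ → List ℚ → ℚ
  esym zero    xs       = 1ℚ
  esym (suc r) []       = 0ℚ
  esym (suc r) (x ∷ xs) = esym (suc r) xs + x * esym r xs

  ∏1- : List ℚ → ℚ
  ∏1- []       = 1ℚ
  ∏1- (x ∷ xs) = (1ℚ - x) * ∏1- xs

  ∑ : List ℚ → ℚ
  ∑ []       = 0ℚ
  ∑ (x ∷ xs) = x + ∑ xs

  Unit : ℚ → Set
  Unit x = 0ℚ ≤ x × x ≤ 1ℚ

  map-Unit : ∀ {v : ℕ → ℚ} → (∀ p → Unit (v p)) → ∀ ps → All Unit (map v ps)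
  map-Unit u ps = All.map⁺ (All.universal u ps)

  ∏1-≥0 : ∀ {xs} → All Unit xs → 0ℚ ≤ ∏1- xs
  ∏1-≥0 []               = 0≤1
  ∏1-≥0 ((_ , x≤1) ∷ us) = 0≤* (≤⇒0≤diff x≤1) (∏1-≥0 us)

  ∏1-≤1 : ∀ {xs} → All Unit xs → ∏1- xs ≤ 1ℚ
  ∏1-≤1 [] = ≤-refl
  ∏1-≤1 {x ∷ xs} ((0≤x , x≤1) ∷ us) =
    diff-≥0⇒≤ (solve 2 (λ x v → con 1ℚ :- (con 1ℚ :- x) :* v := (con 1ℚ :- v) :+ x :* v) refl x (∏1- xs))
      (0≤+ (≤⇒0≤diff (∏1-≤1 us)) (0≤* 0≤x (∏1-≥0 us)))

  ∏1-≥1-∑ : ∀ {xs} → All Unit xs → 1ℚ - ∑ xs ≤ ∏1- xs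
  ∏1-≥1-∑ [] = ≤-refl
  ∏1-≥1-∑ {x ∷ xs} ((0≤x , x≤1) ∷ us) =
    diff-≥0⇒≤ (solve 3 (λ x v s → (con 1ℚ :- x) :* v :- (con 1ℚ :- (x :+ s)) := (v :- (con 1ℚ :- s)) :+ x :* (con 1ℚ :- v)) refl x (∏1- xs) (∑ xs))
      (0≤+ (≤⇒0≤diff (∏1-≥1-∑ us)) (0≤* 0≤x (≤⇒0≤diff (∏1-≤1 us))))

  ∏1-++ : ∀ xs ys → ∏1- (xs ++ ys) ≡ ∏1- xs * ∏1- ys
  ∏1-++ []       ys = sym (*-identityˡ _)
  ∏1-++ (x ∷ xs) ys = trans (cong ((1ℚ - x) *_) (∏1-++ xs ys)) (sym (*-assoc (1ℚ - x) (∏1- xs) (∏1- ys)))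

  ∑-++ : ∀ xs ys → ∑ (xs ++ ys) ≡ ∑ xs + ∑ ys
  ∑-++ []       ys = sym (+-identityˡ _)
  ∑-++ (x ∷ xs) ys = trans (cong (x +_) (∑-++ xs ys)) (sym (+-assoc x (∑ xs) (∑ ys)))

  esym≥0 : ∀ r {xs} → All Unit xs → 0ℚ ≤ esym r xs
  esym≥0 zero    us               = 0≤1
  esym≥0 (suc r) []               = ≤-refl
  esym≥0 (suc r) ((0≤x , _) ∷ us) = 0≤+ (esym≥0 (suc r) us) (0≤* 0≤x (esym≥0 r us))

  double : ℕ → ℕ
  double zero    = zero
  double (suc c) = suc (suc (double c))

  -- Bonferroni inequalities, for arbitrary weights in [0, 1]: weights in {0, 1} give the
  -- pointwise sieve inequalities and the weights 1/p give the main terms.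
  mutual
    ∏≤altSum-even : ∀ c {xs} → All Unit xs → ∏1- xs ≤ altSum (double c) xs
    ∏≤altSum-even zero    us = ∏1-≤1 us
    ∏≤altSum-even (suc c) [] = ≤-refl
    ∏≤altSum-even (suc c) {x ∷ xs} ((0≤x , _) ∷ us) =
      diff-≥0⇒≤ (solve 4 (λ x v a b → (a :- x :* b) :- (con 1ℚ :- x) :* v := (a :- v) :+ x :* (v :- b)) refl
                   x (∏1- xs) (altSum (double (suc c)) xs) (altSum (suc (double c)) xs))
        (0≤+ (≤⇒0≤diff (∏≤altSum-even (suc c) us)) (0≤* 0≤x (≤⇒0≤diff (altSum-odd≤∏ c us))))

    altSum-odd≤∏ : ∀ c {xs} → All Unit xs → altSum (suc (double c)) xs ≤ ∏1- xs
    altSum-odd≤∏ c [] = ≤-refl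
    altSum-odd≤∏ c {x ∷ xs} ((0≤x , _) ∷ us) =
      diff-≥0⇒≤ (solve 4 (λ x v a b → (con 1ℚ :- x) :* v :- (a :- x :* b) := (v :- a) :+ x :* (b :- v)) refl
                   x (∏1- xs) (altSum (suc (double c)) xs) (altSum (double c) xs))
        (0≤+ (≤⇒0≤diff (altSum-odd≤∏ c us)) (0≤* 0≤x (≤⇒0≤diff (∏≤altSum-even c us))))

  mutual
    -- `altSum b` is the partial sum 1 - e₁ + e₂ - ⋯ up to degree b, so consecutive truncations
    -- differ by a single symmetric sum. The lower bound of odd level thus reads: `altSum b` minus e
    -- of degree b + 1, with b even.
    altSum-odd : ∀ c xs → altSum (suc (double c)) xs ≡ altSum (double c) xs - esym (suc (double c)) xs
    altSum-odd zero    []       = refl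
    altSum-odd (suc c) []       = refl
    altSum-odd zero    (x ∷ xs) = begin
      altSum 1 xs - x * 1ℚ          ≡⟨ cong (_- x * 1ℚ) (altSum-odd zero xs) ⟩
      (1ℚ - esym 1 xs) - x * 1ℚ     ≡⟨ solve 3 (λ o e y → (o :- e) :- y := o :- (e :+ y)) refl 1ℚ (esym 1 xs) (x * 1ℚ) ⟩
      1ℚ - (esym 1 xs + x * 1ℚ)     ∎
      where open ≡-Reasoning
    altSum-odd (suc c) (x ∷ xs) = trans
      (cong₂ (λ a b → a - x * b) (altSum-odd (suc c) xs) (altSum-even c xs))
      (solve 5 (λ x a e b f → (a :- e) :- x :* (b :+ f) := (a :- x :* b) :- (e :+ x :* f)) refl
        x (altSum (double (suc c)) xs) (esym (suc (double (suc c))) xs) (altSum (suc (double c)) xs) (esym (double (suc c)) xs))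

    altSum-even : ∀ c xs → altSum (double (suc c)) xs ≡ altSum (suc (double c)) xs + esym (double (suc c)) xs
    altSum-even c []       = refl
    altSum-even c (x ∷ xs) = trans
      (cong₂ (λ a b → a - x * b) (altSum-even c xs) (altSum-odd c xs))
      (solve 5 (λ x a e b f → (a :+ e) :- x :* (b :- f) := (a :- x :* b) :+ (e :+ x :* f)) refl
        x (altSum (suc (double c)) xs) (esym (double (suc c)) xs) (altSum (double c) xs) (esym (suc (double c)) xs))

  -- In ∑ · e_r every product of r + 1 distinct entries occurs r + 1 times, once for each entry
  -- singled out; products with a repeated entry only add to it. Iterated, this gives e_r ≤ ∑^r /
  -- r!.
  esym-newton : ∀ r {xs} → All Unit xs → ι (suc r) * esym (suc r) xs ≤ ∑ xs * esym r xs
  esym-newton r [] = ≤-reflexive (trans (*-zeroʳ (ι (suc r))) (sym (*-zeroˡ (esym r []))))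
  esym-newton zero {x ∷ xs} ((0≤x , _) ∷ us) =
    diff-≥0⇒≤ (solve 3 (λ x s e → (x :+ s) :* con 1ℚ :- con (ι 1) :* (e :+ x :* con 1ℚ) := s :* con 1ℚ :- con (ι 1) :* e) refl
                 x (∑ xs) (esym 1 xs))
      (≤⇒0≤diff (esym-newton zero us))
  esym-newton (suc r) {x ∷ xs} ((0≤x , _) ∷ us) =
    diff-≥0⇒≤ (solve 6 (λ x s n e₀ e₁ e₂ →
                   (x :+ s) :* (e₁ :+ x :* e₀) :- (con 1ℚ :+ n) :* (e₂ :+ x :* e₁)
                   := ((s :* e₁ :- (con 1ℚ :+ n) :* e₂) :+ x :* (s :* e₀ :- n :* e₁)) :+ x :* x :* e₀) refl
                 x (∑ xs) (ι (suc r)) (esym r xs) (esym (suc r) xs) (esym (suc (suc r)) xs))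
      (0≤+ (0≤+ (≤⇒0≤diff (esym-newton (suc r) us)) (0≤* 0≤x (≤⇒0≤diff (esym-newton r us))))
           (0≤* (0≤* 0≤x 0≤x) (esym≥0 r us)))

  -- Sieve weights as formal polynomials.

  infixl 6 _⊕_ _⊖_
  infixr 7 _⊙_

  -- Formal sums of signed squarefree products of primes; p ⊙ P multiplies P by p.
  -- Evaluating at p ↦ [p ∣ r] gives a sieve weight at r, at p ↦ 1/p its mean value.
  data Poly : Set where
    nil one : Poly
    _⊕_ _⊖_ : Poly → Poly → Poly
    _⊙_     : ℕ → Poly → Poly

  eval : (ℕ → ℚ) → Poly → ℚ
  eval v nil     = 0ℚ
  eval v one     = 1ℚ
  eval v (P ⊕ Q) = eval v P + eval v Q
  eval v (P ⊖ Q) = eval v P - eval v Q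
  eval v (p ⊙ P) = v p * eval v P

  size : Poly → ℕ
  size nil     = 0
  size one     = 1
  size (P ⊕ Q) = size P ℕ.+ size Q
  size (P ⊖ Q) = size P ℕ.+ size Q
  size (p ⊙ P) = size P

  -- `R`, the sieve of the smaller primes, is grafted onto the leaves. The result stays an explicit
  -- sum of monomials, and along each branch the primes of `ps` come before those of `R`.
  altP : ℕ → List ℕ → Poly → Poly
  altP zero    ps       R = R
  altP (suc b) []       R = R
  altP (suc b) (p ∷ ps) R = altP (suc b) ps R ⊖ p ⊙ altP b ps R

  esymP : ℕ → List ℕ → Poly → Poly
  esymP zero    ps       R = R
  esymP (suc r) []       R = nil
  esymP (suc r) (p ∷ ps) R = esymP (suc r) ps R ⊕ p ⊙ esymP r ps R

  fullP : List ℕ → Poly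
  fullP []       = one
  fullP (p ∷ ps) = fullP ps ⊖ p ⊙ fullP ps

  module _ (v : ℕ → ℚ) where

    eval-altP : ∀ b ps R → eval v (altP b ps R) ≡ altSum b (map v ps) * eval v R
    eval-altP zero    ps       R = sym (*-identityˡ _)
    eval-altP (suc b) []       R = sym (*-identityˡ _)
    eval-altP (suc b) (p ∷ ps) R = trans
      (cong₂ (λ x y → x - v p * y) (eval-altP (suc b) ps R) (eval-altP b ps R))
      (solve 4 (λ x a b r → a :* r :- x :* (b :* r) := (a :- x :* b) :* r) refl
         (v p) (altSum (suc b) (map v ps)) (altSum b (map v ps)) (eval v R))

    eval-esymP : ∀ b ps R → eval v (esymP b ps R) ≡ esym b (map v ps) * eval v R
    eval-esymP zero    ps       R = sym (*-identityˡ _)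
    eval-esymP (suc b) []       R = sym (*-zeroˡ (eval v R))
    eval-esymP (suc b) (p ∷ ps) R = trans
      (cong₂ (λ x y → x + v p * y) (eval-esymP (suc b) ps R) (eval-esymP b ps R))
      (solve 4 (λ x a b r → a :* r :+ x :* (b :* r) := (a :+ x :* b) :* r) refl
         (v p) (esym (suc b) (map v ps)) (esym b (map v ps)) (eval v R))

    eval-fullP : ∀ ps → eval v (fullP ps) ≡ ∏1- (map v ps)
    eval-fullP []       = refl
    eval-fullP (p ∷ ps) = trans
      (cong (λ x → x - v p * x) (eval-fullP ps))
      (solve 2 (λ x a → a :- x :* a := (con 1ℚ :- x) :* a) refl (v p) (∏1- (map v ps)))

  -- The monomials in front of `R` are sets of at most b primes, and each such set can be written
  -- into b slots holding a prime or nothing.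
  size-altP : ∀ b ps R → size (altP b ps R) ℕ.≤ suc (length ps) ℕ.^ b ℕ.* size R
  size-altP zero    ps R = ℕ.≤-reflexive (sym (ℕ.*-identityˡ _))
  size-altP (suc b) [] R = ℕ.≤-reflexive (sym (trans (cong (ℕ._* size R) (ℕ.^-zeroˡ (suc b))) (ℕ.*-identityˡ _)))
  size-altP (suc b) (p ∷ ps) R = begin
    size (altP (suc b) ps R) ℕ.+ size (altP b ps R)       ≤⟨ ℕ.+-mono-≤ (size-altP (suc b) ps R) (size-altP b ps R) ⟩
    l ℕ.* l ℕ.^ b ℕ.* size R ℕ.+ l ℕ.^ b ℕ.* size R       ≡⟨ sym (ℕ.*-distribʳ-+ (size R) (l ℕ.* l ℕ.^ b) (l ℕ.^ b)) ⟩
    (l ℕ.* l ℕ.^ b ℕ.+ l ℕ.^ b) ℕ.* size R                ≡⟨ cong (ℕ._* size R) (ℕ.+-comm (l ℕ.* l ℕ.^ b) (l ℕ.^ b)) ⟩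
    suc l ℕ.* l ℕ.^ b ℕ.* size R                          ≤⟨ ℕ.*-monoˡ-≤ (size R) (ℕ.*-monoʳ-≤ (suc l) (ℕ.^-monoˡ-≤ b (ℕ.n≤1+n l))) ⟩
    suc l ℕ.^ suc b ℕ.* size R                            ∎
    where open ℕ.≤-Reasoning
          l = suc (length ps)

  size-esymP : ∀ b ps R → size (esymP b ps R) ℕ.≤ suc (length ps) ℕ.^ b ℕ.* size R
  size-esymP zero    ps R = ℕ.≤-reflexive (sym (ℕ.*-identityˡ _))
  size-esymP (suc b) [] R = ℕ.z≤n
  size-esymP (suc b) (p ∷ ps) R = begin
    size (esymP (suc b) ps R) ℕ.+ size (esymP b ps R)     ≤⟨ ℕ.+-mono-≤ (size-esymP (suc b) ps R) (size-esymP b ps R) ⟩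
    l ℕ.* l ℕ.^ b ℕ.* size R ℕ.+ l ℕ.^ b ℕ.* size R       ≡⟨ sym (ℕ.*-distribʳ-+ (size R) (l ℕ.* l ℕ.^ b) (l ℕ.^ b)) ⟩
    (l ℕ.* l ℕ.^ b ℕ.+ l ℕ.^ b) ℕ.* size R                ≡⟨ cong (ℕ._* size R) (ℕ.+-comm (l ℕ.* l ℕ.^ b) (l ℕ.^ b)) ⟩
    suc l ℕ.* l ℕ.^ b ℕ.* size R                          ≤⟨ ℕ.*-monoˡ-≤ (size R) (ℕ.*-monoʳ-≤ (suc l) (ℕ.^-monoˡ-≤ b (ℕ.n≤1+n l))) ⟩
    suc l ℕ.^ suc b ℕ.* size R                            ∎
    where open ℕ.≤-Reasoning
          l = suc (length ps)

  size-fullP : ∀ ps → size (fullP ps) ≡ 2 ℕ.^ length ps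
  size-fullP []       = refl
  size-fullP (p ∷ ps) = trans (cong (λ x → x ℕ.+ x) (size-fullP ps)) (cong (2 ℕ.^ length ps ℕ.+_) (sym (ℕ.+-identityʳ _)))

  -- Sums over intervals

  -- Every product d p₁ ⋯ pₛ along a branch of the polynomial consists of new primes only.
  Fresh : ℕ → Poly → Set
  Fresh d nil     = ⊤
  Fresh d one     = ⊤
  Fresh d (P ⊕ Q) = Fresh d P × Fresh d Q
  Fresh d (P ⊖ Q) = Fresh d P × Fresh d Q
  Fresh d (p ⊙ P) = Prime p × p ∤ d × Fresh (d ℕ.* p) P

  ind : ∀ {A : Set} → Dec A → ℚ
  ind (yes _) = 1ℚ
  ind (no  _) = 0ℚ

  [_∣_] : ℕ → ℕ → ℚ
  [ d ∣ r ] = ind (d ∣? r)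

  ind-Unit : ∀ {A : Set} (d : Dec A) → Unit (ind d)
  ind-Unit (yes _) = 0≤1 , ≤-refl
  ind-Unit (no  _) = ≤-refl , 0≤1

  ind-yes : ∀ {A : Set} (d : Dec A) → A → ind d ≡ 1ℚ
  ind-yes (yes _) a = refl
  ind-yes (no ¬a) a = contradiction a ¬a

  ind-no : ∀ {A : Set} (d : Dec A) → ¬ A → ind d ≡ 0ℚ
  ind-no (yes a) ¬a = contradiction a ¬a
  ind-no (no _)  ¬a = refl

  [∣]-* : ∀ d p r → Prime p → p ∤ d → [ d ∣ r ] * [ p ∣ r ] ≡ [ d ℕ.* p ∣ r ]
  [∣]-* d p r pr p∤d with d ∣? r | p ∣? r
  ... | no d∤r  | y       = trans (*-zeroˡ (ind y)) (sym (ind-no (d ℕ.* p ∣? r) (λ dp∣r → d∤r (∣-trans (m∣m*n p) dp∣r))))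
  ... | yes d∣r | no p∤r  = sym (ind-no (d ℕ.* p ∣? r) (λ dp∣r → p∤r (∣-trans (n∣m*n d) dp∣r)))
  ... | yes (divides q refl) | yes p∣r with euclidsLemma q d pr p∣r
  ...   | inj₂ p∣d = contradiction p∣d p∤d
  ...   | inj₁ (divides k refl) = sym (ind-yes (d ℕ.* p ∣? k ℕ.* p ℕ.* d)
            (divides k (trans (ℕ.*-assoc k p d) (cong (k ℕ.*_) (ℕ.*-comm p d)))))

  count : ℕ → ℕ → ℕ
  count d zero    = 0
  count d (suc x) with d ∣? x
  ... | yes _ = suc (count d x)
  ... | no  _ = count d x

  -- Since 0 counts as a multiple, `d * count d x` is x rounded up to a multiple of d.
  count-bounds : ∀ d → 1 ℕ.≤ d → ∀ x → x ℕ.≤ d ℕ.* count d x × d ℕ.* count d x ℕ.< x ℕ.+ d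
  count-bounds d 1≤d zero = ℕ.z≤n , subst (ℕ._< d) (sym (ℕ.*-zeroʳ d)) 1≤d
  count-bounds d 1≤d (suc x) with count-bounds d 1≤d x | d ∣? x
  ... | lo , hi | yes (divides q refl) = 
          subst (suc (q ℕ.* d) ℕ.≤_) (sym eq) (ℕ.+-monoˡ-≤ (q ℕ.* d) 1≤d)
        , subst (ℕ._< suc (q ℕ.* d ℕ.+ d)) (sym eq) (ℕ.≤-reflexive (cong suc (ℕ.+-comm d (q ℕ.* d))))
    where
      instance _ = ℕ.>-nonZero 1≤d
      c = count d (q ℕ.* d)
      q≤c : q ℕ.≤ c
      q≤c = ℕ.*-cancelˡ-≤ d (subst (ℕ._≤ d ℕ.* c) (ℕ.*-comm q d) lo)
      c<1+q : c ℕ.< suc q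
      c<1+q = ℕ.*-cancelˡ-< d c (suc q) (subst (d ℕ.* c ℕ.<_) (trans (ℕ.+-comm (q ℕ.* d) d) (ℕ.*-comm (suc q) d)) hi)
      eq : d ℕ.* suc c ≡ d ℕ.+ q ℕ.* d
      eq = trans (cong (λ k → d ℕ.* suc k) (ℕ.≤-antisym (ℕ.s≤s⁻¹ c<1+q) q≤c)) (ℕ.*-comm d (suc q))
  ... | lo , hi | no d∤x =
          ℕ.≤∧≢⇒< lo (λ eq → d∤x (divides (count d x) (trans eq (ℕ.*-comm d (count d x)))))
        , ℕ.m<n⇒m<1+n hi

  ∑< : (ℕ → ℚ) → ℕ → ℚ
  ∑< f zero    = 0ℚ
  ∑< f (suc x) = ∑< f x + f x

  ∑<-cong : ∀ {f g} → (∀ r → f r ≡ g r) → ∀ x → ∑< f x ≡ ∑< g x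
  ∑<-cong eq zero    = refl
  ∑<-cong eq (suc x) = cong₂ _+_ (∑<-cong eq x) (eq x)

  ∑<-+ : ∀ f g x → ∑< (λ r → f r + g r) x ≡ ∑< f x + ∑< g x
  ∑<-+ f g zero    = refl
  ∑<-+ f g (suc x) = trans (cong (_+ (f x + g x)) (∑<-+ f g x))
    (solve 4 (λ a b c d → (a :+ b) :+ (c :+ d) := (a :+ c) :+ (b :+ d)) refl (∑< f x) (∑< g x) (f x) (g x))

  ∑<-- : ∀ f g x → ∑< (λ r → f r - g r) x ≡ ∑< f x - ∑< g x
  ∑<-- f g zero    = refl
  ∑<-- f g (suc x) = trans (cong (_+ (f x - g x)) (∑<-- f g x))
    (solve 4 (λ a b c d → (a :- b) :+ (c :- d) := (a :+ c) :- (b :+ d)) refl (∑< f x) (∑< g x) (f x) (g x))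

  ∑<-0 : ∀ x → ∑< (λ _ → 0ℚ) x ≡ 0ℚ
  ∑<-0 zero    = refl
  ∑<-0 (suc x) = cong (_+ 0ℚ) (∑<-0 x)

  ∑<-count : ∀ d x → ∑< (λ r → [ d ∣ r ]) x ≡ ι (count d x)
  ∑<-count d zero = refl
  ∑<-count d (suc x) with d ∣? x
  ... | yes _ = trans (+-comm (∑< (λ r → [ d ∣ r ]) x) 1ℚ) (cong (1ℚ +_) (∑<-count d x))
  ... | no  _ = trans (+-identityʳ (∑< (λ r → [ d ∣ r ]) x)) (∑<-count d x)

  recip-* : ∀ m n → .{{_ : ℕ.NonZero m}} → .{{_ : ℕ.NonZero n}} → recip (m ℕ.* n) ≡ recip m * recip n
  recip-* (suc m) (suc n) = begin
    c                                     ≡⟨ sym (*-identityʳ c) ⟩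
    c * 1ℚ                                ≡⟨ cong (c *_) (sym (cong₂ _*_ (ι*recip m) (ι*recip n))) ⟩
    c * ((ι (suc m) * a) * (ι (suc n) * b))
       ≡⟨ solve 5 (λ c m a n b → c :* ((m :* a) :* (n :* b)) := (m :* n) :* c :* (a :* b)) refl c (ι (suc m)) a (ι (suc n)) b ⟩
    (ι (suc m) * ι (suc n)) * c * (a * b) ≡⟨ cong (λ z → z * c * (a * b)) (sym (ι-* (suc m) (suc n))) ⟩
    ι (suc m ℕ.* suc n) * c * (a * b)     ≡⟨ cong (_* (a * b)) (ι*recip (n ℕ.+ m ℕ.* suc n)) ⟩
    1ℚ * (a * b)                          ≡⟨ *-identityˡ (a * b) ⟩
    a * b                                 ∎
    where open ≡-Reasoning
          a = recip (suc m)
          b = recip (suc n)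
          c = recip (suc m ℕ.* suc n)

  record Near (a b : ℚ) (n : ℕ) : Set where
    constructor near
    field
      ≤ʳ : a ≤ b + ι n
      ≤ˡ : b ≤ a + ι n

  near-+ : ∀ {a b c d m n} → Near a b m → Near c d n → Near (a + c) (b + d) (m ℕ.+ n)
  near-+ {a} {b} {c} {d} {m} {n} (near p q) (near r s) = near (lem b d p r) (lem a c q s)
    where
      lem : ∀ {x y} z w → x ≤ z + ι m → y ≤ w + ι n → x + y ≤ (z + w) + ι (m ℕ.+ n)
      lem z w h k = ≤-trans (+-mono-≤ h k) (≤-reflexive (trans
        (solve 4 (λ z w m n → (z :+ m) :+ (w :+ n) := (z :+ w) :+ (m :+ n)) refl z w (ι m) (ι n))
        (cong (z + w +_) (sym (ι-+ m n)))))

  near-neg : ∀ {c d n} → Near c d n → Near (- c) (- d) n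
  near-neg {c} {d} {n} (near p q) = near (lem q) (lem p)
    where
      lem : ∀ {x y} → x ≤ y + ι n → - y ≤ - x + ι n
      lem {x} {y} h = diff-≥0⇒≤ (solve 3 (λ x y n → (:- x :+ n) :- (:- y) := (y :+ n) :- x) refl x y (ι n)) (≤⇒0≤diff h)

  near-- : ∀ {a b c d m n} → Near a b m → Near c d n → Near (a - c) (b - d) (m ℕ.+ n)
  near-- h k = near-+ h (near-neg k)

  near-≡ : ∀ {a a′ b b′ n} → a ≡ a′ → b ≡ b′ → Near a b n → Near a′ b′ n
  near-≡ refl refl h = h

  indicators : ℕ → ℕ → ℚ
  indicators r p = [ p ∣ r ]

  -- A monomial with product D sums to the number of multiples of D below x, which differs from x/D
  -- by at most 1; the total error is therefore the number of monomials. Here d collects the primes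
  -- already passed on the branch, and `Fresh` makes their indicators multiply.
  ∑<-eval : ∀ P d x → 1 ℕ.≤ d → Fresh d P →
    Near (∑< (λ r → [ d ∣ r ] * eval (indicators r) P) x) (ι x * recip d * eval recip P) (size P)
  ∑<-eval nil d x 1≤d fr =
    near-≡ (sym (trans (∑<-cong (λ r → *-zeroʳ [ d ∣ r ]) x) (∑<-0 x))) (sym (*-zeroʳ (ι x * recip d)))
      (near ≤-refl ≤-refl)
  ∑<-eval one (suc d) x 1≤d fr =
    near-≡ (sym (trans (∑<-cong (λ r → *-identityʳ [ suc d ∣ r ]) x) (∑<-count (suc d) x))) (sym (*-identityʳ _))
      (near (*-cancelˡ (0<ι d) upper) (*-cancelˡ (0<ι d) lower))
    where
      D = ι (suc d)
      c = ι (count (suc d) x)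
      bounds = count-bounds (suc d) 1≤d x
      lem : D * (ι x * recip (suc d)) ≡ ι x
      lem = trans (solve 3 (λ D x r → D :* (x :* r) := x :* (D :* r)) refl D (ι x) (recip (suc d)))
                  (trans (cong (ι x *_) (ι*recip d)) (*-identityʳ (ι x)))
      upper : D * c ≤ D * (ι x * recip (suc d) + ι 1)
      upper = begin
        D * c                                       ≡⟨ sym (ι-* (suc d) (count (suc d) x)) ⟩
        ι (suc d ℕ.* count (suc d) x)               ≤⟨ ι-mono (ℕ.<⇒≤ (proj₂ bounds)) ⟩
        ι (x ℕ.+ suc d)                             ≡⟨ ι-+ x (suc d) ⟩
        ι x + D                                     ≡⟨ cong (_+ D) (sym lem) ⟩
        D * (ι x * recip (suc d)) + D               ≡⟨ solve 2 (λ D y → D :* y :+ D := D :* (y :+ con (ι 1))) refl D (ι x * recip (suc d)) ⟩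
        D * (ι x * recip (suc d) + ι 1)             ∎
        where open ≤-Reasoning
      lower : D * (ι x * recip (suc d)) ≤ D * (c + ι 1)
      lower = begin
        D * (ι x * recip (suc d))                   ≡⟨ lem ⟩
        ι x                                         ≤⟨ ι-mono (proj₁ bounds) ⟩
        ι (suc d ℕ.* count (suc d) x)               ≡⟨ ι-* (suc d) (count (suc d) x) ⟩
        D * c                                       ≤⟨ *-monoˡ (0≤ι (suc d)) (≤-trans (≤-reflexive (sym (+-identityʳ c))) (+-monoʳ-≤ c (0≤ι 1))) ⟩
        D * (c + ι 1)                               ∎
        where open ≤-Reasoning
  ∑<-eval (P ⊕ Q) d x 1≤d (frP , frQ) =
    near-≡ (sym (trans (∑<-cong (λ r → *-distribˡ-+ [ d ∣ r ] (eval (indicators r) P) (eval (indicators r) Q)) x)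
                       (∑<-+ (λ r → [ d ∣ r ] * eval (indicators r) P) (λ r → [ d ∣ r ] * eval (indicators r) Q) x)))
           (sym (*-distribˡ-+ (ι x * recip d) (eval recip P) (eval recip Q)))
      (near-+ (∑<-eval P d x 1≤d frP) (∑<-eval Q d x 1≤d frQ))
  ∑<-eval (P ⊖ Q) d x 1≤d (frP , frQ) =
    near-≡ (sym (trans (∑<-cong (λ r → dist [ d ∣ r ] (eval (indicators r) P) (eval (indicators r) Q)) x)
                       (∑<-- (λ r → [ d ∣ r ] * eval (indicators r) P) (λ r → [ d ∣ r ] * eval (indicators r) Q) x)))
           (sym (dist (ι x * recip d) (eval recip P) (eval recip Q)))
      (near-- (∑<-eval P d x 1≤d frP) (∑<-eval Q d x 1≤d frQ))
    where
      dist : ∀ a b c → a * (b - c) ≡ a * b - a * c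
      dist = solve 3 (λ a b c → a :* (b :- c) := a :* b :- a :* c) refl
  ∑<-eval (p ⊙ P) d x 1≤d (pr , p∤d , fr) =
    near-≡ (∑<-cong (λ r → trans (cong (_* eval (indicators r) P) (sym ([∣]-* d p r pr p∤d)))
                                 (*-assoc [ d ∣ r ] [ p ∣ r ] (eval (indicators r) P))) x)
           (trans (cong (λ z → ι x * z * eval recip P) (recip-* d p))
             (solve 4 (λ x d p e → x :* (d :* p) :* e := x :* d :* (p :* e)) refl (ι x) (recip d) (recip p) (eval recip P)))
      (∑<-eval P (d ℕ.* p) x (ℕ.*-mono-≤ 1≤d (ℕ.>-nonZero⁻¹ p)) fr)
    where instance
      _ = ℕ.>-nonZero 1≤d
      _ = prime⇒nonZero pr

  ∑<-increase : ∀ f a y → ∑< f a < ∑< f (y ℕ.+ a) → ∃[ r ] a ℕ.≤ r × r ℕ.< y ℕ.+ a × 0ℚ < f r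
  ∑<-increase f a zero    lt = contradiction lt (<-irrefl refl)
  ∑<-increase f a (suc y) lt with 0ℚ <? f (y ℕ.+ a)
  ... | yes pos = y ℕ.+ a , ℕ.m≤n+m a y , ℕ.≤-refl , pos
  ... | no ¬pos with ∑<-increase f a y (<-≤-trans lt (≤-trans (+-monoʳ-≤ (∑< f (y ℕ.+ a)) (≮⇒≥ ¬pos)) (≤-reflexive (+-identityʳ (∑< f (y ℕ.+ a))))))
  ...   | r , a≤r , r<y+a , pos = r , a≤r , ℕ.m<n⇒m<1+n r<y+a , pos

  -- Divisors coprime to the remaining primes.

  AvoidsBelow : ℕ → ℕ → Set
  AvoidsBelow B d = ∀ q → Prime q → q ℕ.< B → q ∤ d

  prime∣prime⇒≡ : ∀ {p q} → Prime p → Prime q → q ∣ p → q ≡ p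
  prime∣prime⇒≡ pp pq q∣p with prime⇒irreducible pp q∣p
  ... | inj₁ refl = contradiction pq ¬prime[1]
  ... | inj₂ q≡p  = q≡p

  avoids-* : ∀ {B d p} → AvoidsBelow B d → Prime p → B ℕ.≤ p → AvoidsBelow B (d ℕ.* p)
  avoids-* {B} {d} {p} av pp B≤p q pq q<B q∣dp with euclidsLemma d p pq q∣dp
  ... | inj₁ q∣d = av q pq q<B q∣d
  ... | inj₂ q∣p with refl ← prime∣prime⇒≡ pp pq q∣p = contradiction q<B (ℕ.≤⇒≯ B≤p)

  ∤-* : ∀ {d p ps} → Prime p → All Prime ps → All (p ≢_) ps → All (_∤ d) ps → All (_∤ d ℕ.* p) ps
  ∤-* pp [] [] [] = []
  ∤-* {d} {p} pp (pq ∷ prs) (p≢q ∷ nes) (q∤d ∷ nds) = (λ q∣dp → case q∣dp) ∷ ∤-* pp prs nes nds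
    where
      case : _ ∣ d ℕ.* p → _
      case q∣dp with euclidsLemma d p pq q∣dp
      ... | inj₁ q∣d = q∤d q∣d
      ... | inj₂ q∣p = p≢q (sym (prime∣prime⇒≡ pp pq q∣p))

  module _ {B : ℕ} {R : Poly} (frR : ∀ d → AvoidsBelow B d → Fresh d R) where

    -- Larger primes are treated first: all primes of `ps` are at least B, so the divisor collected
    -- on the way to `R` still has no prime factor below B, as `frR` requires.
    fresh-altP : ∀ b {ps} d → All Prime ps → All (B ℕ.≤_) ps → AllPairs _≢_ ps → All (_∤ d) ps →
                 AvoidsBelow B d → Fresh d (altP b ps R)
    fresh-altP zero    d prs ges nes nds av = frR d av
    fresh-altP (suc b) {[]} d prs ges nes nds av = frR d av
    fresh-altP (suc b) {p ∷ ps} d (pp ∷ prs) (ge ∷ ges) (ne ∷ nes) (nd ∷ nds) av =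
      fresh-altP (suc b) d prs ges nes nds av ,
      pp , nd , fresh-altP b (d ℕ.* p) prs ges nes (∤-* pp prs ne nds) (avoids-* av pp ge)

    fresh-esymP : ∀ b {ps} d → All Prime ps → All (B ℕ.≤_) ps → AllPairs _≢_ ps → All (_∤ d) ps →
                  AvoidsBelow B d → Fresh d (esymP b ps R)
    fresh-esymP zero    d prs ges nes nds av = frR d av
    fresh-esymP (suc b) {[]} d prs ges nes nds av = tt
    fresh-esymP (suc b) {p ∷ ps} d (pp ∷ prs) (ge ∷ ges) (ne ∷ nes) (nd ∷ nds) av =
      fresh-esymP (suc b) d prs ges nes nds av ,
      pp , nd , fresh-esymP b (d ℕ.* p) prs ges nes (∤-* pp prs ne nds) (avoids-* av pp ge)

  fresh-fullP : ∀ {ps} d → All Prime ps → AllPairs _≢_ ps → All (_∤ d) ps → Fresh d (fullP ps)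
  fresh-fullP {[]} d prs nes nds = tt
  fresh-fullP {p ∷ ps} d (pp ∷ prs) (ne ∷ nes) (nd ∷ nds) =
    fresh-fullP d prs nes nds , pp , nd , fresh-fullP (d ℕ.* p) prs nes (∤-* pp prs ne nds)

  -- Primes in intervals.

  primesIn : ℕ → ℕ → List ℕ
  primesIn a zero    = []
  primesIn a (suc l) with prime? a
  ... | yes _ = a ∷ primesIn (suc a) l
  ... | no  _ = primesIn (suc a) l

  primesIn-prime : ∀ a l → All Prime (primesIn a l)
  primesIn-prime a zero = []
  primesIn-prime a (suc l) with prime? a
  ... | yes pa = pa ∷ primesIn-prime (suc a) l
  ... | no  _  = primesIn-prime (suc a) l

  primesIn-≥ : ∀ a l → All (a ℕ.≤_) (primesIn a l)
  primesIn-≥ a zero = []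
  primesIn-≥ a (suc l) with prime? a
  ... | yes _ = ℕ.≤-refl ∷ All.map ℕ.<⇒≤ (primesIn-≥ (suc a) l)
  ... | no  _ = All.map ℕ.<⇒≤ (primesIn-≥ (suc a) l)

  primesIn-< : ∀ a l → All (ℕ._< a ℕ.+ l) (primesIn a l)
  primesIn-< a zero = []
  primesIn-< a (suc l) with prime? a | subst (λ z → All (ℕ._< z) (primesIn (suc a) l)) (sym (ℕ.+-suc a l)) (primesIn-< (suc a) l)
  ... | yes _ | ih = ℕ.m<m+n a ℕ.z<s ∷ ih
  ... | no  _ | ih = ih

  primesIn-sorted : ∀ a l → AllPairs ℕ._<_ (primesIn a l)
  primesIn-sorted a zero = []
  primesIn-sorted a (suc l) with prime? a
  ... | yes _ = primesIn-≥ (suc a) l ∷ primesIn-sorted (suc a) l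
  ... | no  _ = primesIn-sorted (suc a) l

  length-primesIn : ∀ a l → length (primesIn a l) ℕ.≤ l
  length-primesIn a zero = ℕ.z≤n
  length-primesIn a (suc l) with prime? a
  ... | yes _ = ℕ.s≤s (length-primesIn (suc a) l)
  ... | no  _ = ℕ.m≤n⇒m≤1+n (length-primesIn (suc a) l)

  ∈-primesIn : ∀ a l {q} → Prime q → a ℕ.≤ q → q ℕ.< a ℕ.+ l → q ∈ primesIn a l
  ∈-primesIn a zero    pq a≤q q<a = contradiction (subst (_ ℕ.<_) (ℕ.+-identityʳ a) q<a) (ℕ.≤⇒≯ a≤q)
  ∈-primesIn a (suc l) {q} pq a≤q q<a with prime? a | a ℕ.≟ q
  ... | yes _  | yes refl = here refl
  ... | no ¬pa | yes refl = contradiction pq ¬pa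
  ... | yes _  | no a≢q   = there (∈-primesIn (suc a) l pq (ℕ.≤∧≢⇒< a≤q a≢q) (subst (q ℕ.<_) (ℕ.+-suc a l) q<a))
  ... | no _   | no a≢q   = ∈-primesIn (suc a) l pq (ℕ.≤∧≢⇒< a≤q a≢q) (subst (q ℕ.<_) (ℕ.+-suc a l) q<a)

  -- Chebyshev's bound from central binomial coefficients.

  nCk≤2^n : ∀ n k → n C k ℕ.≤ 2 ℕ.^ n
  nCk≤2^n zero    zero    = ℕ.≤-refl
  nCk≤2^n zero    (suc k) = ℕ.z≤n
  nCk≤2^n (suc n) zero    = ℕ.m^n>0 2 (suc n)
  nCk≤2^n (suc n) (suc k) = begin
    suc n C suc k                ≡⟨ sym (nCk+nC[k+1]≡[n+1]C[k+1] n k) ⟩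
    n C k ℕ.+ n C (suc k)        ≤⟨ ℕ.+-mono-≤ (nCk≤2^n n k) (nCk≤2^n n (suc k)) ⟩
    2 ℕ.^ n ℕ.+ 2 ℕ.^ n          ≡⟨ cong (2 ℕ.^ n ℕ.+_) (sym (ℕ.+-identityʳ _)) ⟩
    2 ℕ.^ suc n                  ∎
    where open ℕ.≤-Reasoning

  prime∣!⇒≤ : ∀ {p} n → Prime p → p ∣ n ! → p ℕ.≤ n
  prime∣!⇒≤ zero    pp p∣1 = contradiction (subst Prime (∣1⇒≡1 p∣1) pp) ¬prime[1]
  prime∣!⇒≤ (suc n) pp p∣n! with euclidsLemma (suc n) (n !) pp p∣n!
  ... | inj₁ p∣1+n = ∣⇒≤ p∣1+n
  ... | inj₂ p∣n!′ = ℕ.m≤n⇒m≤1+n (prime∣!⇒≤ n pp p∣n!′)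

  n∣n! : ∀ n → .{{ℕ.NonZero n}} → n ∣ n !
  n∣n! (suc n) = m∣m*n (n !)

  central*factorials : ∀ n → ((n ℕ.+ n) C n) ℕ.* (n ! ℕ.* (n ℕ.+ n ℕ.∸ n) !) ≡ (n ℕ.+ n) !
  central*factorials n = trans (cong (ℕ._* (n ! ℕ.* (n ℕ.+ n ℕ.∸ n) !)) (nCk≡n!/k![n-k]! (ℕ.m≤m+n n n)))
                               (m/n*n≡m (k![n∸k]!∣n! (ℕ.m≤m+n n n)))
    where instance _ = n ℕ.!* (n ℕ.+ n ℕ.∸ n) !≢0

  prime∣central : ∀ {p} n → Prime p → n ℕ.< p → p ℕ.≤ n ℕ.+ n → p ∣ (n ℕ.+ n) C n
  prime∣central {p} n pp n<p p≤2n with euclidsLemma ((n ℕ.+ n) C n) (n ! ℕ.* (n ℕ.+ n ℕ.∸ n) !) pp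
    (subst (p ∣_) (sym (central*factorials n)) (∣-trans (n∣n! p {{prime⇒nonZero pp}}) (m≤n⇒m!∣n! p≤2n)))
  ... | inj₁ p∣C = p∣C
  ... | inj₂ p∣! with euclidsLemma (n !) ((n ℕ.+ n ℕ.∸ n) !) pp p∣!
  ...   | inj₁ p∣n!  = contradiction n<p (ℕ.≤⇒≯ (prime∣!⇒≤ n pp p∣n!))
  ...   | inj₂ p∣n!′ = contradiction n<p (ℕ.≤⇒≯ (prime∣!⇒≤ n pp (subst (λ k → p ∣ k !) (ℕ.m+n∸n≡m n n) p∣n!′)))

  product∣ : ∀ {ps} n → All Prime ps → AllPairs _≢_ ps → All (_∣ n) ps → product ps ∣ n
  product∣ n [] [] [] = 1∣ n
  product∣ {p ∷ ps} n (pp ∷ prs) (ne ∷ nes) (divides q refl ∷ ds) =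
    subst (p ℕ.* product ps ∣_) (ℕ.*-comm p q) (*-monoʳ-∣ p (product∣ q prs nes (cancel prs ne ds)))
    where
      cancel : ∀ {rs} → All Prime rs → All (p ≢_) rs → All (_∣ q ℕ.* p) rs → All (_∣ q) rs
      cancel [] [] [] = []
      cancel (pr ∷ prs) (p≢r ∷ nes) (r∣qp ∷ ds) with euclidsLemma q p pr r∣qp
      ... | inj₁ r∣q = r∣q ∷ cancel prs nes ds
      ... | inj₂ r∣p = contradiction (sym (prime∣prime⇒≡ pp pr r∣p)) p≢r

  ^length≤product : ∀ a {ps} → All (a ℕ.≤_) ps → a ℕ.^ length ps ℕ.≤ product ps
  ^length≤product a []         = ℕ.≤-refl
  ^length≤product a (a≤p ∷ ps) = ℕ.*-mono-≤ a≤p (^length≤product a ps)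

  2^-cancel-≤ : ∀ {m n} → 2 ℕ.^ m ℕ.≤ 2 ℕ.^ n → m ℕ.≤ n
  2^-cancel-≤ {m} {n} le with m ℕ.≤? n
  ... | yes m≤n = m≤n
  ... | no  m≰n = contradiction (ℕ.^-monoʳ-< 2 ℕ.≤-refl (ℕ.≰⇒> m≰n)) (ℕ.≤⇒≯ le)

  dyadic : ℕ → List ℕ
  dyadic i = primesIn (2 ℕ.^ i) (2 ℕ.^ i)

  2^-not-prime : ∀ i → ¬ Prime (2 ℕ.^ suc (suc i))
  2^-not-prime i pr with prime⇒irreducible pr (divides {2} (2 ℕ.^ suc i) (ℕ.*-comm 2 (2 ℕ.^ suc i)))
  ... | inj₁ ()
  ... | inj₂ eq = contradiction (2^-cancel-≤ {suc (suc i)} {1} (ℕ.≤-reflexive (sym eq))) (ℕ.<⇒≱ (ℕ.s≤s (ℕ.s≤s ℕ.z≤n)))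

  -- With N = 2^i, the product of the primes in [N, 2N) divides the binomial coefficient of 2N over
  -- N, which is at most 2^(2N), while each of these primes is at least 2^i. Comparing exponents of
  -- 2 gives the bound.
  chebyshev : ∀ i → 2 ℕ.≤ i → i ℕ.* length (dyadic i) ℕ.≤ 2 ℕ.* 2 ℕ.^ i
  chebyshev i@(suc (suc i′)) (ℕ.s≤s (ℕ.s≤s _)) = 2^-cancel-≤ (begin
    2 ℕ.^ (i ℕ.* length (dyadic i))   ≡⟨ sym (ℕ.^-*-assoc 2 i (length (dyadic i))) ⟩
    N ℕ.^ length (dyadic i)           ≤⟨ ^length≤product N (primesIn-≥ N N) ⟩
    product (dyadic i)                ≤⟨ ∣⇒≤ {{ℕ.>-nonZero (ℕ.<-≤-trans ℕ.z<s central>0)}}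
                                          (product∣ _ (primesIn-prime N N) (AllPairs.map ℕ.<⇒≢ (primesIn-sorted N N)) divs) ⟩
    (N ℕ.+ N) C N                     ≤⟨ nCk≤2^n (N ℕ.+ N) N ⟩
    2 ℕ.^ (N ℕ.+ N)                   ≡⟨ cong (λ z → 2 ℕ.^ (N ℕ.+ z)) (sym (ℕ.+-identityʳ N)) ⟩
    2 ℕ.^ (2 ℕ.* N)                   ∎)
    where
      open ℕ.≤-Reasoning
      N = 2 ℕ.^ i
      central>0 : 1 ℕ.≤ (N ℕ.+ N) C N
      central>0 = ℕ.n≢0⇒n>0 λ eq → ℕ.≢-nonZero⁻¹ _ {{(N ℕ.+ N) ℕ.!≢0}}
        (trans (sym (central*factorials N)) (cong (ℕ._* (N ! ℕ.* (N ℕ.+ N ℕ.∸ N) !)) eq))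
      divs : All (_∣ (N ℕ.+ N) C N) (dyadic i)
      divs = All.tabulate λ {p} p∈ →
        let pp = All.lookup (primesIn-prime N N) p∈ in
        prime∣central N pp
          -- The interval contains its left end N, where `prime∣central` would fail; N is composite
          -- because i ≥ 2.
          (ℕ.≤∧≢⇒< (All.lookup (primesIn-≥ N N) p∈) (λ eq → 2^-not-prime i′ (subst Prime (sym eq) pp)))
          (ℕ.<⇒≤ (All.lookup (primesIn-< N N) p∈))

  recip-antitone : ∀ {m n} → 1 ℕ.≤ m → m ℕ.≤ n → recip n ≤ recip m
  recip-antitone {suc m} {suc n} _ m≤n = *-cancelˡ (0<ι n) (begin
    ι (suc n) * recip (suc n)   ≡⟨ ι*recip n ⟩
    1ℚ                          ≡⟨ sym (ι*recip m) ⟩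
    ι (suc m) * recip (suc m)   ≤⟨ *-monoʳ (0≤recip (suc m)) (ι-mono m≤n) ⟩
    ι (suc n) * recip (suc m)   ∎)
    where open ≤-Reasoning

  recip-Unit : ∀ n → Unit (recip n)
  recip-Unit zero    = ≤-refl , 0≤1
  recip-Unit (suc n) = 0≤recip (suc n) , recip-antitone {1} {suc n} ℕ.≤-refl (ℕ.s≤s ℕ.z≤n)

  ∑-recip≤ : ∀ a {ps} → 1 ℕ.≤ a → All (a ℕ.≤_) ps → ∑ (map recip ps) ≤ ι (length ps) * recip a
  ∑-recip≤ a 1≤a [] = ≤-reflexive (sym (*-zeroˡ (recip a)))
  ∑-recip≤ a {p ∷ ps} 1≤a (a≤p ∷ ges) = ≤-trans
    (+-mono-≤ (recip-antitone 1≤a a≤p) (∑-recip≤ a 1≤a ges))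
    (≤-reflexive (solve 2 (λ r l → r :+ l :* r := (con 1ℚ :+ l) :* r) refl (recip a) (ι (length ps))))

  ι*recip′ : ∀ n → 1 ℕ.≤ n → ι n * recip n ≡ 1ℚ
  ι*recip′ (suc n) _ = ι*recip n

  ∑-dyadic : ∀ i → 2 ℕ.≤ i → ι i * ∑ (map recip (dyadic i)) ≤ ι 2
  ∑-dyadic i 2≤i = begin
    ι i * ∑ (map recip (dyadic i))             ≤⟨ *-monoˡ (0≤ι i) (∑-recip≤ N 1≤N (primesIn-≥ N N)) ⟩
    ι i * (ι (length (dyadic i)) * recip N)    ≡⟨ sym (*-assoc (ι i) (ι (length (dyadic i))) (recip N)) ⟩
    ι i * ι (length (dyadic i)) * recip N      ≡⟨ cong (_* recip N) (sym (ι-* i (length (dyadic i)))) ⟩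
    ι (i ℕ.* length (dyadic i)) * recip N      ≤⟨ *-monoʳ (0≤recip N) (ι-mono (chebyshev i 2≤i)) ⟩
    ι (2 ℕ.* N) * recip N                      ≡⟨ cong (_* recip N) (ι-* 2 N) ⟩
    ι 2 * ι N * recip N                        ≡⟨ *-assoc (ι 2) (ι N) (recip N) ⟩
    ι 2 * (ι N * recip N)                      ≡⟨ cong (ι 2 *_) (ι*recip′ N 1≤N) ⟩
    ι 2 * 1ℚ                                   ≡⟨ *-identityʳ (ι 2) ⟩
    ι 2                                        ∎
    where open ≤-Reasoning
          N = 2 ℕ.^ i
          1≤N = ℕ.m^n>0 2 i

  -- Reciprocal sums and products over blocks of primes.

  block : ℕ → ℕ → List ℕ
  block i zero    = []
  block i (suc r) = dyadic i ++ block (suc i) r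

  block-prime : ∀ i r → All Prime (block i r)
  block-prime i zero    = []
  block-prime i (suc r) = All.++⁺ (primesIn-prime (2 ℕ.^ i) (2 ℕ.^ i)) (block-prime (suc i) r)

  2^i+2^i : ∀ i → 2 ℕ.^ i ℕ.+ 2 ℕ.^ i ≡ 2 ℕ.^ suc i
  2^i+2^i i = cong (2 ℕ.^ i ℕ.+_) (sym (ℕ.+-identityʳ _))

  block-≥ : ∀ i r → All (2 ℕ.^ i ℕ.≤_) (block i r)
  block-≥ i zero    = []
  block-≥ i (suc r) = All.++⁺ (primesIn-≥ (2 ℕ.^ i) (2 ℕ.^ i))
    (All.map (ℕ.≤-trans (ℕ.^-monoʳ-≤ 2 (ℕ.n≤1+n i))) (block-≥ (suc i) r))

  dyadic-< : ∀ i → All (ℕ._< 2 ℕ.^ suc i) (dyadic i)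
  dyadic-< i = subst (λ z → All (ℕ._< z) (dyadic i)) (2^i+2^i i) (primesIn-< (2 ℕ.^ i) (2 ℕ.^ i))

  block-< : ∀ i r → All (ℕ._< 2 ℕ.^ (r ℕ.+ i)) (block i r)
  block-< i zero    = []
  block-< i (suc r) = All.++⁺
    (All.map (λ lt → ℕ.<-≤-trans lt (ℕ.^-monoʳ-≤ 2 (ℕ.s≤s (ℕ.m≤n+m i r)))) (dyadic-< i))
    (subst (λ z → All (ℕ._< 2 ℕ.^ z) (block (suc i) r)) (ℕ.+-suc r i) (block-< (suc i) r))

  block-distinct : ∀ i r → AllPairs _≢_ (block i r)
  block-distinct i zero    = []
  block-distinct i (suc r) = AllPairs.++⁺
    (AllPairs.map ℕ.<⇒≢ (primesIn-sorted (2 ℕ.^ i) (2 ℕ.^ i)))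
    (block-distinct (suc i) r)
    (All.map (λ lt → All.map (λ ge → ℕ.<⇒≢ (ℕ.<-≤-trans lt ge)) (block-≥ (suc i) r)) (dyadic-< i))

  length-block : ∀ i r → 2 ℕ.^ i ℕ.+ length (block i r) ℕ.≤ 2 ℕ.^ (r ℕ.+ i)
  length-block i zero    = ℕ.≤-reflexive (ℕ.+-identityʳ _)
  length-block i (suc r) = begin
    N ℕ.+ length (dyadic i ++ block (suc i) r)                 ≡⟨ cong (N ℕ.+_) (length-++ (dyadic i)) ⟩
    N ℕ.+ (length (dyadic i) ℕ.+ length (block (suc i) r))     ≤⟨ ℕ.+-monoʳ-≤ N (ℕ.+-monoˡ-≤ _ (length-primesIn N N)) ⟩
    N ℕ.+ (N ℕ.+ length (block (suc i) r))                     ≡⟨ sym (ℕ.+-assoc N N _) ⟩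
    N ℕ.+ N ℕ.+ length (block (suc i) r)                       ≡⟨ cong (ℕ._+ length (block (suc i) r)) (2^i+2^i i) ⟩
    2 ℕ.^ suc i ℕ.+ length (block (suc i) r)                   ≤⟨ length-block (suc i) r ⟩
    2 ℕ.^ (r ℕ.+ suc i)                                        ≡⟨ cong (2 ℕ.^_) (ℕ.+-suc r i) ⟩
    2 ℕ.^ (suc r ℕ.+ i)                                        ∎
    where open ℕ.≤-Reasoning
          N = 2 ℕ.^ i

  ∈-block : ∀ i r {q} → Prime q → 2 ℕ.^ i ℕ.≤ q → q ℕ.< 2 ℕ.^ (r ℕ.+ i) → q ∈ block i r
  ∈-block i zero pq ge lt = contradiction lt (ℕ.≤⇒≯ ge)
  ∈-block i (suc r) {q} pq ge lt with 2 ℕ.^ suc i ℕ.≤? q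
  ... | yes ge′ = ∈-++⁺ʳ (dyadic i) (∈-block (suc i) r pq ge′ (subst (λ z → q ℕ.< 2 ℕ.^ z) (sym (ℕ.+-suc r i)) lt))
  ... | no ¬ge′ = ∈-++⁺ˡ (∈-primesIn (2 ℕ.^ i) (2 ℕ.^ i) pq ge (subst (q ℕ.<_) (sym (2^i+2^i i)) (ℕ.≰⇒> ¬ge′)))

  harmonic : ℕ → ℕ → ℚ
  harmonic i zero    = 0ℚ
  harmonic i (suc r) = recip i + harmonic (suc i) r

  ∑-block≤harmonic : ∀ i r → 2 ℕ.≤ i → ∑ (map recip (block i r)) ≤ ι 2 * harmonic i r
  ∑-block≤harmonic i zero    2≤i = ≤-reflexive (sym (*-zeroʳ (ι 2)))
  ∑-block≤harmonic i@(suc i′) (suc r) 2≤i = begin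
    ∑ (map recip (dyadic i ++ block (suc i) r))                      ≡⟨ cong ∑ (map-++ recip (dyadic i) (block (suc i) r)) ⟩
    ∑ (map recip (dyadic i) ++ map recip (block (suc i) r))          ≡⟨ ∑-++ (map recip (dyadic i)) _ ⟩
    ∑ (map recip (dyadic i)) + ∑ (map recip (block (suc i) r))       ≤⟨ +-mono-≤ first (∑-block≤harmonic (suc i) r (ℕ.m≤n⇒m≤1+n 2≤i)) ⟩
    ι 2 * recip i + ι 2 * harmonic (suc i) r                         ≡⟨ sym (*-distribˡ-+ (ι 2) (recip i) _) ⟩
    ι 2 * harmonic i (suc r)                                         ∎
    where
      open ≤-Reasoning
      s = ∑ (map recip (dyadic i))
      first : s ≤ ι 2 * recip i
      first = *-cancelˡ (0<ι i′) (begin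
        ι i * s                ≤⟨ ∑-dyadic i 2≤i ⟩
        ι 2                    ≡⟨ sym (*-identityʳ (ι 2)) ⟩
        ι 2 * 1ℚ               ≡⟨ cong (ι 2 *_) (sym (ι*recip i′)) ⟩
        ι 2 * (ι i * recip i)  ≡⟨ solve 3 (λ a b c → a :* (b :* c) := b :* (a :* c)) refl (ι 2) (ι i) (recip i) ⟩
        ι i * (ι 2 * recip i)  ∎)

  harmonic-snoc : ∀ i r → harmonic i (suc r) ≡ harmonic i r + recip (r ℕ.+ i)
  harmonic-snoc i zero    = trans (+-identityʳ (recip i)) (sym (+-identityˡ (recip i)))
  harmonic-snoc i (suc r) = begin
    recip i + harmonic (suc i) (suc r)                       ≡⟨ cong (λ z → recip i + z) (harmonic-snoc (suc i) r) ⟩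
    recip i + (harmonic (suc i) r + recip (r ℕ.+ suc i))     ≡⟨ sym (+-assoc (recip i) (harmonic (suc i) r) (recip (r ℕ.+ suc i))) ⟩
    recip i + harmonic (suc i) r + recip (r ℕ.+ suc i)       ≡⟨ cong (λ z → recip i + harmonic (suc i) r + recip z) (ℕ.+-suc r i) ⟩
    recip i + harmonic (suc i) r + recip (suc r ℕ.+ i)       ∎
    where open ≡-Reasoning

  recip-double : ∀ i → 1 ℕ.≤ i → recip (i ℕ.+ i) + recip (i ℕ.+ i) ≡ recip i
  recip-double i@(suc i′) 1≤i = begin
    recip (i ℕ.+ i) + recip (i ℕ.+ i)   ≡⟨ cong (λ z → recip z + recip z) (cong (i ℕ.+_) (sym (ℕ.+-identityʳ i))) ⟩
    recip (2 ℕ.* i) + recip (2 ℕ.* i)   ≡⟨ cong (λ z → z + z) (recip-* 2 i) ⟩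
    recip 2 * recip i + recip 2 * recip i ≡⟨ solve 1 (λ x → con (recip 2) :* x :+ con (recip 2) :* x := x) refl (recip i) ⟩
    recip i ∎
    where open ≡-Reasoning

  -- Going from i to i + 1 removes 1/i = 1/(2i) + 1/(2i) and adds 1/(2i) + 1/(2i + 1). One numerical
  -- check then settles all later blocks.
  harmonic-antitone : ∀ i → 1 ℕ.≤ i → harmonic (suc i) (suc i) ≤ harmonic i i
  harmonic-antitone i 1≤i = diff-≥0⇒≤ {r = c - b} eq (≤⇒0≤diff (recip-antitone (ℕ.≤-trans 1≤i (ℕ.m≤m+n i i)) (ℕ.n≤1+n _)))
    where
      open ≡-Reasoning
      a = recip i
      b = recip (suc i ℕ.+ i)
      c = recip (i ℕ.+ i)
      h = harmonic i i
      h′ = harmonic (suc i) (suc i)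
      sum : a + h′ ≡ h + c + b
      sum = trans (harmonic-snoc i (suc i)) (cong (_+ b) (harmonic-snoc i i))
      eq : h - h′ ≡ c - b
      eq = begin
        h - h′                          ≡⟨ solve 3 (λ h h′ a → h :- h′ := h :- ((a :+ h′) :- a)) refl h h′ a ⟩
        h - ((a + h′) - a)              ≡⟨ cong₂ (λ x y → h - (x - y)) sum (sym (recip-double i 1≤i)) ⟩
        h - ((h + c + b) - (c + c))     ≡⟨ solve 3 (λ h c b → h :- ((h :+ c :+ b) :- (c :+ c)) := c :- b) refl h c b ⟩
        c - b                           ∎

  harmonic-bound : ∀ k → ι 2 * harmonic (k ℕ.+ 40) (k ℕ.+ 40) ≤ ℤ.+ 7 / 5
  -- The values decrease to 2 log 2 = 1.386...; at 40 the sum is about 1.399, just under 7/5.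
  harmonic-bound zero    = toWitness {a? = ι 2 * harmonic 40 40 ℚ.≤? ℤ.+ 7 / 5} _
  harmonic-bound (suc k) = ≤-trans (*-monoˡ (0≤ι 2) (harmonic-antitone (k ℕ.+ 40) (ℕ.≤-trans (ℕ.s≤s ℕ.z≤n) (ℕ.m≤n+m 40 k)))) (harmonic-bound k)

  ∑-block≤ : ∀ i → 40 ℕ.≤ i → ∑ (map recip (block i i)) ≤ ℤ.+ 7 / 5
  ∑-block≤ i 40≤i = ≤-trans (∑-block≤harmonic i i (ℕ.≤-trans (ℕ.s≤s (ℕ.s≤s ℕ.z≤n)) 40≤i))
    (subst (λ z → ι 2 * harmonic z z ≤ ℤ.+ 7 / 5) (ℕ.m∸n+n≡m 40≤i) (harmonic-bound (i ℕ.∸ 40)))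

  ∏-dyadic : ∀ i → ι i ≤ ι (2 ℕ.+ i) * ∏1- (map recip (dyadic (2 ℕ.+ i)))
  ∏-dyadic i = begin
    ι i                            ≡⟨ solve 1 (λ x → x := (con 1ℚ :+ (con 1ℚ :+ x)) :- con (ι 2)) refl (ι i) ⟩
    n - ι 2                        ≤⟨ +-monoʳ-≤ n (neg-antimono-≤ (∑-dyadic (2 ℕ.+ i) (ℕ.s≤s (ℕ.s≤s ℕ.z≤n)))) ⟩
    n - n * ∑ xs                   ≡⟨ solve 2 (λ n s → n :- n :* s := n :* (con 1ℚ :- s)) refl n (∑ xs) ⟩
    n * (1ℚ - ∑ xs)                ≤⟨ *-monoˡ (0≤ι (2 ℕ.+ i)) (∏1-≥1-∑ (map-Unit recip-Unit (dyadic (2 ℕ.+ i)))) ⟩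
    n * ∏1- xs                     ∎
    where open ≤-Reasoning
          n = ι (2 ℕ.+ i)
          xs = map recip (dyadic (2 ℕ.+ i))

  -- The factors 1 − 2/i telescope.
  ∏-block : ∀ i r → ι (i ℕ.* suc i) ≤ ι ((i ℕ.+ r) ℕ.* suc (i ℕ.+ r)) * ∏1- (map recip (block (2 ℕ.+ i) r))
  ∏-block i zero    = ≤-reflexive (trans (cong (λ z → ι (z ℕ.* suc z)) (sym (ℕ.+-identityʳ i))) (sym (*-identityʳ _)))
  ∏-block i (suc r) = *-cancelˡ (0<ι (suc i)) (begin
    n * ι (i ℕ.* suc i)                       ≡⟨ cong (n *_) (ι-* i (suc i)) ⟩
    n * (ι i * ι (suc i))                     ≡⟨ solve 3 (λ n a b → n :* (a :* b) := a :* (b :* n)) refl n (ι i) (ι (suc i)) ⟩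
    ι i * (ι (suc i) * n)                     ≡⟨ cong (ι i *_) (sym (ι-* (suc i) (2 ℕ.+ i))) ⟩
    ι i * ι (suc i ℕ.* suc (suc i))           ≤⟨ *-mono (0≤ι i) (0≤* (0≤ι W) (∏1-≥0 (map-Unit recip-Unit (block (3 ℕ.+ i) r)))) (∏-dyadic i)
                                                   (∏-block (suc i) r) ⟩
    (n * ∏1- xs) * (ι W * ∏1- ys)             ≡⟨ solve 4 (λ n x w y → (n :* x) :* (w :* y) := n :* (w :* (x :* y))) refl n (∏1- xs) (ι W) (∏1- ys) ⟩
    n * (ι W * (∏1- xs * ∏1- ys))             ≡⟨ cong₂ (λ u v → n * (ι u * v)) (cong (λ z → z ℕ.* suc z) (sym (ℕ.+-suc i r))) (sym (trans (cong ∏1- (map-++ recip (dyadic (2 ℕ.+ i)) (block (3 ℕ.+ i) r))) (∏1-++ xs ys))) ⟩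
    n * (ι ((i ℕ.+ suc r) ℕ.* suc (i ℕ.+ suc r)) * ∏1- (map recip (block (2 ℕ.+ i) (suc r)))) ∎)
    where open ≤-Reasoning
          n = ι (2 ℕ.+ i)
          xs = map recip (dyadic (2 ℕ.+ i))
          ys = map recip (block (3 ℕ.+ i) r)
          W = (suc i ℕ.+ r) ℕ.* suc (suc i ℕ.+ r)

  -- `∏-block` gives the lower bound i(i + 1) / ((2i + 2)(2i + 3)), which tends to 1/4. Asking only
  -- for 6/25 reduces to 24 i + 36 ≤ 25 i.
  ∏-block≥′ : ∀ i → 36 ℕ.≤ i → ι 6 ≤ ι 25 * ∏1- (map recip (block (2 ℕ.+ i) (2 ℕ.+ i)))
  ∏-block≥′ i 36≤i = *-cancelˡ {r = ι W} (subst (λ z → 0ℚ < ι (z ℕ.* suc z)) (sym (ℕ.+-suc i (suc i))) (0<ι (suc (i ℕ.+ suc i) ℕ.+ (i ℕ.+ suc i) ℕ.* suc (suc (i ℕ.+ suc i))))) (begin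
    ι W * ι 6                     ≡⟨ sym (ι-* W 6) ⟩
    ι (W ℕ.* 6)                   ≤⟨ ι-mono nat ⟩
    ι (25 ℕ.* (i ℕ.* suc i))      ≡⟨ ι-* 25 (i ℕ.* suc i) ⟩
    ι 25 * ι (i ℕ.* suc i)        ≤⟨ *-monoˡ (0≤ι 25) (∏-block i (2 ℕ.+ i)) ⟩
    ι 25 * (ι W * V)              ≡⟨ solve 3 (λ a b c → a :* (b :* c) := b :* (a :* c)) refl (ι 25) (ι W) V ⟩
    ι W * (ι 25 * V)              ∎)
    where
      open ≤-Reasoning
      W = (i ℕ.+ (2 ℕ.+ i)) ℕ.* suc (i ℕ.+ (2 ℕ.+ i))
      V = ∏1- (map recip (block (2 ℕ.+ i) (2 ℕ.+ i)))
      id₁ : ∀ i → (i ℕ.+ (2 ℕ.+ i)) ℕ.* suc (i ℕ.+ (2 ℕ.+ i)) ℕ.* 6 ≡ suc i ℕ.* (24 ℕ.* i) ℕ.+ suc i ℕ.* 36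
      id₁ = solve-∀
      id₂ : ∀ i → suc i ℕ.* (24 ℕ.* i) ℕ.+ suc i ℕ.* i ≡ 25 ℕ.* (i ℕ.* suc i)
      id₂ = solve-∀
      nat : W ℕ.* 6 ℕ.≤ 25 ℕ.* (i ℕ.* suc i)
      nat = ℕ.≤-trans (ℕ.≤-reflexive (id₁ i)) (ℕ.≤-trans (ℕ.+-monoʳ-≤ (suc i ℕ.* (24 ℕ.* i)) (ℕ.*-monoʳ-≤ (suc i) 36≤i)) (ℕ.≤-reflexive (id₂ i)))

  ∏-block≥ : ∀ i → 40 ℕ.≤ i → ι 6 ≤ ι 25 * ∏1- (map recip (block i i))
  ∏-block≥ (suc zero)    (ℕ.s≤s ())
  ∏-block≥ (suc (suc i)) 40≤i = ∏-block≥′ i (ℕ.≤-trans (ℕ.m≤m+n 36 2) (ℕ.s≤s⁻¹ (ℕ.s≤s⁻¹ 40≤i)))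

  -- Truncation levels and their losses.

  half-depth : ℕ → ℕ
  half-depth j = 2 ℕ.+ (j ℕ.∸ 4)

  -- Truncation level of the j-th block counted from the largest primes: 4, 4, 4, 4, 4, 6, 8, 10, …
  depth : ℕ → ℕ
  depth j = double (half-depth j)

  -- The share of the sixth and all later blocks. The sixth, cut at level 6, costs less than 0.0088,
  -- within `tail 0 - tail 1` = 1/100, and the bound for each later block is at most 49/100 of the
  -- preceding one, so halving suffices. Together with five blocks at 0.187 this makes 0.955, still
  -- below 1.
  tail : ℕ → ℚ
  tail zero    = ℤ.+ 1 / 50
  tail (suc u) = ½ * tail u

  -- Upper bound for the relative loss caused by the blocks j, j + 1, …: a block with sum of
  -- reciprocals at most 7/5 and product at least 6/25 truncated at level b costs at most
  -- (7/5)^(b+1) / (b+1)! / (6/25), which is less than 0.187 for b = 4.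
  loss : ℕ → ℚ
  loss 0 = ℤ.+ 955 / 1000
  loss 1 = ℤ.+ 768 / 1000
  loss 2 = ℤ.+ 581 / 1000
  loss 3 = ℤ.+ 394 / 1000
  loss 4 = ℤ.+ 207 / 1000
  loss (suc (suc (suc (suc (suc u))))) = tail u

  module _ {xs : List ℚ} (us : All Unit xs) (∑≤ : ∑ xs ≤ ℤ.+ 7 / 5) where

    esym-step : ∀ r {c} n .{{_ : ℕ.NonZero n}} → n ℕ.≤ suc r → esym r xs ≤ c → esym (suc r) xs ≤ ℤ.+ 7 / 5 * recip n * c
    esym-step r {c} n@(suc m) n≤1+r e≤c = *-cancelˡ (0<ι m) (begin
      ι n * esym (suc r) xs              ≤⟨ *-monoʳ (esym≥0 (suc r) us) (ι-mono n≤1+r) ⟩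
      ι (suc r) * esym (suc r) xs        ≤⟨ esym-newton r us ⟩
      ∑ xs * esym r xs                   ≤⟨ *-monoʳ (esym≥0 r us) ∑≤ ⟩
      ℤ.+ 7 / 5 * esym r xs                ≤⟨ *-monoˡ (toWitness {a? = 0ℚ ℚ.≤? ℤ.+ 7 / 5} _) e≤c ⟩
      ℤ.+ 7 / 5 * c                        ≡⟨ sym (*-identityˡ (ℤ.+ 7 / 5 * c)) ⟩
      1ℚ * (ℤ.+ 7 / 5 * c)                 ≡⟨ cong (_* (ℤ.+ 7 / 5 * c)) (sym (ι*recip m)) ⟩
      ι n * recip n * (ℤ.+ 7 / 5 * c)      ≡⟨ solve 4 (λ n r s c → n :* r :* (s :* c) := n :* (s :* r :* c)) refl (ι n) (recip n) (ℤ.+ 7 / 5) c ⟩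
      ι n * (ℤ.+ 7 / 5 * recip n * c)      ∎)
      where open ≤-Reasoning

    private
      c₅ = ℤ.+ 7 / 5 * recip 5 * (ℤ.+ 7 / 5 * recip 4 * (ℤ.+ 7 / 5 * recip 3 * (ℤ.+ 7 / 5 * recip 2 * (ℤ.+ 7 / 5 * recip 1 * 1ℚ))))

    esym₅ : esym 5 xs ≤ c₅
    esym₅ = esym-step 4 5 ℕ.≤-refl (esym-step 3 4 ℕ.≤-refl (esym-step 2 3 ℕ.≤-refl (esym-step 1 2 ℕ.≤-refl (esym-step 0 1 ℕ.≤-refl ≤-refl))))

    esym₇ : esym 7 xs ≤ ℤ.+ 7 / 5 * recip 7 * (ℤ.+ 7 / 5 * recip 6 * c₅)
    esym₇ = esym-step 6 7 ℕ.≤-refl (esym-step 5 6 ℕ.≤-refl esym₅)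

    esym-tail : ∀ u → esym (suc (double (3 ℕ.+ u))) xs ≤ ℤ.+ 6 / 25 * (½ * tail u)
    esym-tail zero    = ≤-trans esym₇ (toWitness {a? = ℤ.+ 7 / 5 * recip 7 * (ℤ.+ 7 / 5 * recip 6 * c₅) ℚ.≤? ℤ.+ 6 / 25 * (½ * tail 0)} _)
    esym-tail (suc u) = begin
      -- Dividing by 2 instead of the true degree already gives the factor (7/10)² = 49/100 < 1/2
      -- that the halving of `tail` needs.
      esym (suc (double (4 ℕ.+ u))) xs     ≤⟨ esym-step (double (4 ℕ.+ u)) 2 (ℕ.s≤s (ℕ.s≤s ℕ.z≤n))
                                               (esym-step (suc (double (3 ℕ.+ u))) 2 (ℕ.s≤s (ℕ.s≤s ℕ.z≤n)) (esym-tail u)) ⟩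
      ℤ.+ 7 / 5 * recip 2 * (ℤ.+ 7 / 5 * recip 2 * (ℤ.+ 6 / 25 * (½ * tail u)))
        ≡⟨ solve 1 (λ t → con (ℤ.+ 7 / 5 * recip 2) :* (con (ℤ.+ 7 / 5 * recip 2) :* (con (ℤ.+ 6 / 25) :* (con ½ :* t))) := con (ℤ.+ 49 / 50) :* (con (ℤ.+ 6 / 25) :* (con ½ :* (con ½ :* t)))) refl (tail u) ⟩
      ℤ.+ 49 / 50 * (ℤ.+ 6 / 25 * (½ * tail (suc u))) ≤⟨ *-monoʳ (0≤* (toWitness {a? = 0ℚ ℚ.≤? ℤ.+ 6 / 25} _) (0≤* (toWitness {a? = 0ℚ ℚ.≤? ½} _) (0≤tail (suc u)))) (toWitness {a? = ℤ.+ 49 / 50 ℚ.≤? 1ℚ} _) ⟩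
      1ℚ * (ℤ.+ 6 / 25 * (½ * tail (suc u))) ≡⟨ *-identityˡ _ ⟩
      ℤ.+ 6 / 25 * (½ * tail (suc u))        ∎
      where
        open ≤-Reasoning
        0≤tail : ∀ u → 0ℚ ≤ tail u
        0≤tail zero    = toWitness {a? = 0ℚ ℚ.≤? ℤ.+ 1 / 50} _
        0≤tail (suc u) = 0≤* (toWitness {a? = 0ℚ ℚ.≤? ½} _) (0≤tail u)

    esym-loss : ∀ j → esym (suc (depth j)) xs ≤ ℤ.+ 6 / 25 * (loss j - loss (suc j))
    esym-loss 0 = ≤-trans esym₅ (toWitness {a? = c₅ ℚ.≤? ℤ.+ 6 / 25 * (loss 0 - loss 1)} _)
    esym-loss 1 = ≤-trans esym₅ (toWitness {a? = c₅ ℚ.≤? ℤ.+ 6 / 25 * (loss 1 - loss 2)} _)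
    esym-loss 2 = ≤-trans esym₅ (toWitness {a? = c₅ ℚ.≤? ℤ.+ 6 / 25 * (loss 2 - loss 3)} _)
    esym-loss 3 = ≤-trans esym₅ (toWitness {a? = c₅ ℚ.≤? ℤ.+ 6 / 25 * (loss 3 - loss 4)} _)
    esym-loss 4 = ≤-trans esym₅ (toWitness {a? = c₅ ℚ.≤? ℤ.+ 6 / 25 * (loss 4 - loss 5)} _)
    esym-loss (suc (suc (suc (suc (suc u))))) = ≤-trans (esym-tail u)
      (≤-reflexive (cong (ℤ.+ 6 / 25 *_) (solve 1 (λ t → con ½ :* t := t :- con ½ :* t) refl (tail u))))

  0≤loss : ∀ j → 0ℚ ≤ loss j
  0≤loss 0 = toWitness {a? = 0ℚ ℚ.≤? loss 0} _
  0≤loss 1 = toWitness {a? = 0ℚ ℚ.≤? loss 1} _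
  0≤loss 2 = toWitness {a? = 0ℚ ℚ.≤? loss 2} _
  0≤loss 3 = toWitness {a? = 0ℚ ℚ.≤? loss 3} _
  0≤loss 4 = toWitness {a? = 0ℚ ℚ.≤? loss 4} _
  0≤loss 5 = toWitness {a? = 0ℚ ℚ.≤? loss 5} _
  0≤loss (suc j@(suc (suc (suc (suc (suc u)))))) = 0≤* (toWitness {a? = 0ℚ ℚ.≤? ½} _) (0≤loss j)

  -- The product of 1 - 1/n over all integers of the interval telescopes to (a + 1)/(a + 1 + l), and
  -- leaving out the composite n only enlarges it. So crude a bound suffices for the bounded set of
  -- smallest primes.
  ∏-primesIn : ∀ a l → ι (suc a) ≤ ι (suc a ℕ.+ l) * ∏1- (map recip (primesIn (2 ℕ.+ a) l))
  ∏-primesIn a zero = ≤-reflexive (trans (cong ι (sym (ℕ.+-identityʳ (suc a)))) (sym (*-identityʳ _)))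
  ∏-primesIn a (suc l) with prime? (2 ℕ.+ a) | subst (λ z → ι (2 ℕ.+ a) ≤ ι (suc z) * ∏1- (map recip (primesIn (3 ℕ.+ a) l))) (sym (ℕ.+-suc a l)) (∏-primesIn (suc a) l)
  ... | no  _ | ih = ≤-trans (ι-mono (ℕ.n≤1+n (suc a))) ih
  ... | yes _ | ih = begin
    ι (suc a)                              ≡⟨ solve 1 (λ x → x := (con 1ℚ :+ x) :- con 1ℚ) refl (ι (suc a)) ⟩
    n - 1ℚ                                 ≡⟨ cong (λ z → n - z) (sym (ι*recip (suc a))) ⟩
    n - n * recip (2 ℕ.+ a)                ≡⟨ solve 2 (λ n r → n :- n :* r := (con 1ℚ :- r) :* n) refl n (recip (2 ℕ.+ a)) ⟩
    (1ℚ - recip (2 ℕ.+ a)) * n             ≤⟨ *-monoˡ (≤⇒0≤diff (proj₂ (recip-Unit (2 ℕ.+ a)))) ih ⟩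
    (1ℚ - recip (2 ℕ.+ a)) * (m * v)       ≡⟨ solve 3 (λ r m v → r :* (m :* v) := m :* (r :* v)) refl (1ℚ - recip (2 ℕ.+ a)) m v ⟩
    m * ((1ℚ - recip (2 ℕ.+ a)) * v)       ∎
    where open ≤-Reasoning
          n = ι (2 ℕ.+ a)
          m = ι (suc a ℕ.+ suc l)
          v = ∏1- (map recip (primesIn (3 ℕ.+ a) l))

  ι-pow : ∀ a b → ι (2 ℕ.^ (6 ℕ.+ (a ℕ.+ b))) ≡ ι 64 * (ι (2 ℕ.^ a) * ι (2 ℕ.^ b))
  ι-pow a b = trans (cong ι (trans (ℕ.^-distribˡ-+-* 2 6 (a ℕ.+ b)) (cong (64 ℕ.*_) (ℕ.^-distribˡ-+-* 2 a b))))
                    (trans (ι-* 64 (2 ℕ.^ a ℕ.* 2 ℕ.^ b)) (cong (ι 64 *_) (ι-* (2 ℕ.^ a) (2 ℕ.^ b))))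

  -- The main term must exceed the errors at both ends of the interval, hence the 2 s on the left.
  -- The factor 64 is the least power of two whose product with 1 - 0.955 is above 2.
  scaled : ∀ {s G u ℓ} → 1 ℕ.≤ s → 1ℚ ≤ ι G * u → (1ℚ - loss 0) * u ≤ ℓ → ι s + ι s < (ι 64 * (ι s * ι G)) * ℓ
  scaled {s} {G} {u} {ℓ} 1≤s 1≤Gu u≤ℓ = begin-strict
    ι s + ι s                                    ≡⟨ solve 1 (λ s → s :+ s := s :* con (ι 2)) refl (ι s) ⟩
    ι s * ι 2                                    <⟨ *-monoʳ-<-pos (ι s) {{ℚ.positive (<-≤-trans 0<1 (ι-mono 1≤s))}}
                                                      (toWitness {a? = ι 2 <? ι 64 * (1ℚ - loss 0) * 1ℚ} _) ⟩
    ι s * (ι 64 * (1ℚ - loss 0) * 1ℚ)            ≤⟨ *-monoˡ (0≤ι s) (*-monoˡ (toWitness {a? = 0ℚ ℚ.≤? ι 64 * (1ℚ - loss 0)} _) 1≤Gu) ⟩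
    ι s * (ι 64 * (1ℚ - loss 0) * (ι G * u))     ≡⟨ solve 5 (λ s a x g u → s :* (a :* x :* (g :* u)) := (a :* (s :* g)) :* (x :* u)) refl (ι s) (ι 64) (1ℚ - loss 0) (ι G) u ⟩
    (ι 64 * (ι s * ι G)) * ((1ℚ - loss 0) * u)   ≤⟨ *-monoˡ (0≤* (0≤ι 64) (0≤* (0≤ι s) (0≤ι G))) u≤ℓ ⟩
    (ι 64 * (ι s * ι G)) * ℓ                     ∎
    where open ≤-Reasoning

  sum-grows : ∀ {S : ℕ → ℚ} {M n} Y → (∀ x → Near (S x) (ι x * recip 1 * M) n) → ι n + ι n < ι Y * M →
              ∀ a → S a < S (Y ℕ.+ a)
  sum-grows {S} {M} {n} Y nearS large a = begin-strict
    S a                                          ≤⟨ Near.≤ʳ (nearS a) ⟩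
    ι a * recip 1 * M + z                        ≡⟨ solve 3 (λ a M z → a :* con (recip 1) :* M :+ z := (z :+ z) :+ (a :* con (recip 1) :* M :- z)) refl (ι a) M z ⟩
    (z + z) + (ι a * recip 1 * M - z)            <⟨ +-monoˡ-< (ι a * recip 1 * M - z) large ⟩
    ι Y * M + (ι a * recip 1 * M - z)            ≡⟨ solve 4 (λ y a M z → y :* M :+ (a :* con (recip 1) :* M :- z) := (y :+ a) :* con (recip 1) :* M :- z) refl (ι Y) (ι a) M z ⟩
    (ι Y + ι a) * recip 1 * M - z                ≡⟨ cong (λ x → x * recip 1 * M - z) (sym (ι-+ Y a)) ⟩
    ι (Y ℕ.+ a) * recip 1 * M - z                ≤⟨ +-monoˡ-≤ (- z) (Near.≤ˡ (nearS (Y ℕ.+ a))) ⟩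
    S (Y ℕ.+ a) + z - z                          ≡⟨ solve 2 (λ s z → s :+ z :- z := s) refl (S (Y ℕ.+ a)) z ⟩
    S (Y ℕ.+ a)                                  ∎
    where open ≤-Reasoning
          z = ι n

  -- The Brun-Hooley sieve.

  scale : ℕ → ℕ → ℕ
  scale w zero    = w
  scale w (suc t) = scale w t ℕ.+ scale w t

  module Sieve (w : ℕ) (40≤w : 40 ℕ.≤ w) where

    -- Doubling by addition makes `2 ^ K (suc t)` definitionally the right end of
    -- `block (K t) (K t)`.
    K : ℕ → ℕ
    K = scale w

    40≤K : ∀ t → 40 ℕ.≤ K t
    40≤K zero    = 40≤w
    40≤K (suc t) = ℕ.≤-trans (40≤K t) (ℕ.m≤m+n (K t) (K t))

    -- These primes get full inclusion-exclusion, with at most 2^(2^w) monomials. For bounded w this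
    -- is a constant, and the block estimates are needed only from 2^40 on.
    base : List ℕ
    base = primesIn 2 (2 ℕ.^ w ℕ.∸ 2)

    2≤2^w : 2 ℕ.≤ 2 ℕ.^ w
    2≤2^w = ℕ.^-monoʳ-≤ 2 {1} {w} (ℕ.≤-trans (ℕ.s≤s ℕ.z≤n) 40≤w)

    Bl : ℕ → List ℕ
    Bl t = block (K t) (K t)

    -- Brun–Hooley: if x ≤ y, y − e ≤ x and ℓ ≤ X ≤ u with all of x, X, y, e nonnegative, then
    -- y ℓ − e u ≤ x X; here y = altSum b, e = esym (b + 1) and x is the sieve indicator of a block.
    U : ℕ → ℕ → Poly
    U zero    j = fullP base
    U (suc t) j = altP (depth j) (Bl t) (U t (suc j))

    L : ℕ → ℕ → Poly
    L zero    j = fullP base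
    L (suc t) j = altP (depth j) (Bl t) (L t (suc j)) ⊖ esymP (suc (depth j)) (Bl t) (U t (suc j))

    primesBelow : ℕ → List ℕ
    primesBelow zero    = base
    primesBelow (suc t) = Bl t ++ primesBelow t

    ∈-primesBelow : ∀ t {q} → Prime q → q ℕ.< 2 ℕ.^ K t → q ∈ primesBelow t
    ∈-primesBelow zero {q} pq q< = ∈-primesIn 2 (2 ℕ.^ w ℕ.∸ 2) pq (ℕ.nonTrivial⇒n>1 q {{prime⇒nonTrivial pq}})
      (subst (q ℕ.<_) (sym (ℕ.m+[n∸m]≡n 2≤2^w)) q<)
    ∈-primesBelow (suc t) {q} pq q< with 2 ℕ.^ K t ℕ.≤? q
    ... | yes ge = ∈-++⁺ˡ (∈-block (K t) (K t) pq ge q<)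
    ... | no ¬ge = ∈-++⁺ʳ (Bl t) (∈-primesBelow t pq (ℕ.≰⇒> ¬ge))

    ∏-primesBelow-suc : ∀ v t → ∏1- (map v (primesBelow (suc t))) ≡ ∏1- (map v (Bl t)) * ∏1- (map v (primesBelow t))
    ∏-primesBelow-suc v t = trans (cong ∏1- (map-++ v (Bl t) (primesBelow t))) (∏1-++ (map v (Bl t)) _)

    module _ (v : ℕ → ℚ) (unit : ∀ p → Unit (v p)) where

      ∏≤U : ∀ t j → ∏1- (map v (primesBelow t)) ≤ eval v (U t j)
      ∏≤U zero    j = ≤-reflexive (sym (eval-fullP v base))
      ∏≤U (suc t) j = begin
        ∏1- (map v (primesBelow (suc t)))                        ≡⟨ ∏-primesBelow-suc v t ⟩
        ∏1- (map v (Bl t)) * ∏1- (map v (primesBelow t))         ≤⟨ *-mono (∏1-≥0 us) (≤-trans (∏1-≥0 (map-Unit unit (primesBelow t))) (∏≤U t (suc j)))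
                                                                      (∏≤altSum-even (half-depth j) us) (∏≤U t (suc j)) ⟩
        altSum (depth j) (map v (Bl t)) * eval v (U t (suc j))   ≡⟨ sym (eval-altP v (depth j) (Bl t) (U t (suc j))) ⟩
        eval v (U (suc t) j)                                     ∎
        where open ≤-Reasoning
              us = map-Unit unit (Bl t)

      L≤∏ : ∀ t j → eval v (L t j) ≤ ∏1- (map v (primesBelow t))
      L≤∏ zero    j = ≤-reflexive (eval-fullP v base)
      L≤∏ (suc t) j = begin
        eval v (L (suc t) j)      ≡⟨ cong₂ _-_ (eval-altP v (depth j) (Bl t) (L t (suc j))) (eval-esymP v (suc (depth j)) (Bl t) (U t (suc j))) ⟩
        a * ℓ - e * u             ≤⟨ diff-≥0⇒≤
                                       (solve 6 (λ a ℓ e u X V → V :* X :- (a :* ℓ :- e :* u) := (a :* (X :- ℓ) :+ e :* (u :- X)) :+ (V :- (a :- e)) :* X) refl a ℓ e u X V)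
                                       (0≤+ (0≤+ (0≤* (≤-trans (∏1-≥0 us) (∏≤altSum-even (half-depth j) us)) (≤⇒0≤diff (L≤∏ t (suc j))))
                                                 (0≤* (esym≥0 (suc (depth j)) us) (≤⇒0≤diff (∏≤U t (suc j)))))
                                            (0≤* (≤⇒0≤diff (≤-trans (≤-reflexive (sym (altSum-odd (half-depth j) (map v (Bl t))))) (altSum-odd≤∏ (half-depth j) us)))
                                                 (∏1-≥0 (map-Unit unit (primesBelow t))))) ⟩
        V * X                     ≡⟨ sym (∏-primesBelow-suc v t) ⟩
        ∏1- (map v (primesBelow (suc t))) ∎
        where open ≤-Reasoning
              us = map-Unit unit (Bl t)
              a = altSum (depth j) (map v (Bl t))
              e = esym (suc (depth j)) (map v (Bl t))
              ℓ = eval v (L t (suc j))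
              u = eval v (U t (suc j))
              X = ∏1- (map v (primesBelow t))
              V = ∏1- (map v (Bl t))

    U≥0 : ∀ t j → 0ℚ ≤ eval recip (U t j)
    U≥0 t j = ≤-trans (∏1-≥0 (map-Unit recip-Unit (primesBelow t))) (∏≤U recip recip-Unit t j)

    -- Comparing with `U` instead of the true product lets the factor a of a block pass through both
    -- sides. The new deficit is e u, and e ≤ 6/25 · (loss j - loss (j + 1)) ≤ a · (loss j - loss (j
    -- + 1)), because a is at least the product over the block.
    main≥ : ∀ t j → (1ℚ - loss j) * eval recip (U t j) ≤ eval recip (L t j)
    main≥ zero    j = diff-≥0⇒≤ (solve 2 (λ x u → u :- (con 1ℚ :- x) :* u := x :* u) refl (loss j) (eval recip (U 0 j))) (0≤* (0≤loss j) (U≥0 0 j))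
    main≥ (suc t) j = begin
      (1ℚ - loss j) * eval recip (U (suc t) j)     ≡⟨ cong ((1ℚ - loss j) *_) (eval-altP recip (depth j) (Bl t) (U t (suc j))) ⟩
      (1ℚ - loss j) * (a * u)                      ≤⟨ diff-≥0⇒≤
          (solve 6 (λ a ℓ e u x x′ → (a :* ℓ :- e :* u) :- (con 1ℚ :- x) :* (a :* u) := a :* (ℓ :- (con 1ℚ :- x′) :* u) :+ ((x :- x′) :* a :- e) :* u) refl a ℓ e u (loss j) (loss (suc j)))
          (0≤+ (0≤* 0≤a (≤⇒0≤diff (main≥ t (suc j)))) (0≤* (≤⇒0≤diff e≤) (U≥0 t (suc j)))) ⟩
      a * ℓ - e * u                                ≡⟨ sym (cong₂ _-_ (eval-altP recip (depth j) (Bl t) (L t (suc j))) (eval-esymP recip (suc (depth j)) (Bl t) (U t (suc j)))) ⟩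
      eval recip (L (suc t) j)                     ∎
      where
        open ≤-Reasoning
        us = map-Unit recip-Unit (Bl t)
        a = altSum (depth j) (map recip (Bl t))
        e = esym (suc (depth j)) (map recip (Bl t))
        ℓ = eval recip (L t (suc j))
        u = eval recip (U t (suc j))
        V = ∏1- (map recip (Bl t))
        V≤a : V ≤ a
        V≤a = ∏≤altSum-even (half-depth j) us
        0≤a : 0ℚ ≤ a
        0≤a = ≤-trans (∏1-≥0 us) V≤a
        bound : esym (suc (depth j)) (map recip (Bl t)) ≤ ℤ.+ 6 / 25 * (loss j - loss (suc j))
        bound = esym-loss us (∑-block≤ (K t) (40≤K t)) j
        0≤Δ : 0ℚ ≤ loss j - loss (suc j)
        -- The sign needs no case split on j: a positive multiple of the difference bounds a
        -- nonnegative symmetric sum.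
        0≤Δ = *-cancelˡ (toWitness {a? = 0ℚ <? ℤ.+ 6 / 25} _) (≤-trans (≤-reflexive (*-zeroʳ (ℤ.+ 6 / 25))) (≤-trans (esym≥0 (suc (depth j)) us) bound))
        6/25≤a : ℤ.+ 6 / 25 ≤ a
        6/25≤a = ≤-trans (*-cancelˡ {r = ι 25} (0<ι 24) (≤-trans (toWitness {a? = ι 25 * (ℤ.+ 6 / 25) ℚ.≤? ι 6} _) (∏-block≥ (K t) (40≤K t)))) V≤a
        e≤ : e ≤ (loss j - loss (suc j)) * a
        e≤ = ≤-trans bound (≤-trans (≤-reflexive (*-comm (ℤ.+ 6 / 25) (loss j - loss (suc j)))) (*-monoˡ 0≤Δ 6/25≤a))

    -- Rounding 6/25 down to 1/8 costs three bits per block. The total w + 3 t is negligible against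
    -- K t = w · 2^t.
    ∏-primesBelow≥ : ∀ t → 1ℚ ≤ ι (2 ℕ.^ (w ℕ.+ 3 ℕ.* t)) * ∏1- (map recip (primesBelow t))
    ∏-primesBelow≥ zero = begin
      1ℚ                                                   ≤⟨ ∏-primesIn 0 (2 ℕ.^ w ℕ.∸ 2) ⟩
      ι (1 ℕ.+ (2 ℕ.^ w ℕ.∸ 2)) * X                        ≤⟨ *-monoʳ (∏1-≥0 (map-Unit recip-Unit base)) (ι-mono le) ⟩
      ι (2 ℕ.^ (w ℕ.+ 0)) * X                              ∎
      where
        open ≤-Reasoning
        X = ∏1- (map recip base)
        le : 1 ℕ.+ (2 ℕ.^ w ℕ.∸ 2) ℕ.≤ 2 ℕ.^ (w ℕ.+ 0)
        le = ℕ.≤-trans (ℕ.n≤1+n _) (ℕ.≤-reflexive (trans (ℕ.m+[n∸m]≡n 2≤2^w) (cong (2 ℕ.^_) (sym (ℕ.+-identityʳ w)))))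
    ∏-primesBelow≥ (suc t) = begin
      1ℚ                              ≡⟨⟩
      1ℚ * 1ℚ                         ≤⟨ *-mono 0≤1 (0≤* (0≤ι G) (∏1-≥0 (map-Unit recip-Unit (primesBelow t)))) eighth (∏-primesBelow≥ t) ⟩
      (ι 8 * V) * (ι G * X)           ≡⟨ solve 4 (λ e v g x → (e :* v) :* (g :* x) := (e :* g) :* (v :* x)) refl (ι 8) V (ι G) X ⟩
      (ι 8 * ι G) * (V * X)           ≡⟨ cong₂ _*_ (trans (sym (ι-* 8 G)) (cong ι (sym expo))) (sym (∏-primesBelow-suc recip t)) ⟩
      ι (2 ℕ.^ (w ℕ.+ 3 ℕ.* suc t)) * ∏1- (map recip (primesBelow (suc t))) ∎
      where
        open ≤-Reasoning
        G = 2 ℕ.^ (w ℕ.+ 3 ℕ.* t)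
        V = ∏1- (map recip (Bl t))
        X = ∏1- (map recip (primesBelow t))
        eighth : 1ℚ ≤ ι 8 * V
        eighth = *-cancelˡ {r = ι 25} (0<ι 24) (begin
          ι 25 * 1ℚ         ≤⟨ toWitness {a? = ι 25 * 1ℚ ℚ.≤? ι 8 * ι 6} _ ⟩
          ι 8 * ι 6         ≤⟨ *-monoˡ (0≤ι 8) (∏-block≥ (K t) (40≤K t)) ⟩
          ι 8 * (ι 25 * V)  ≡⟨ solve 3 (λ a b c → a :* (b :* c) := b :* (a :* c)) refl (ι 8) (ι 25) V ⟩
          ι 25 * (ι 8 * V)  ∎)
        lem : ∀ w t → w ℕ.+ 3 ℕ.* suc t ≡ 3 ℕ.+ (w ℕ.+ 3 ℕ.* t)
        lem = solve-∀
        expo : 2 ℕ.^ (w ℕ.+ 3 ℕ.* suc t) ≡ 8 ℕ.* G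
        expo = trans (cong (2 ℕ.^_) (lem w t)) (ℕ.^-distribˡ-+-* 2 3 (w ℕ.+ 3 ℕ.* t))

    -- Binary logarithm of the bound for the number of monomials. Each further block below the top
    -- weighs half as much per factor, so the cut has to be severe only for the largest primes, and
    -- growing levels below remain cheap.
    sizeExp : ℕ → ℕ → ℕ
    sizeExp zero    j = 2 ℕ.^ w
    sizeExp (suc t) j = K (suc t) ℕ.* depth j ℕ.+ sizeExp t (suc j)

    1+length-Bl≤ : ∀ t → suc (length (Bl t)) ℕ.≤ 2 ℕ.^ K (suc t)
    1+length-Bl≤ t = ℕ.≤-trans (ℕ.+-monoˡ-≤ (length (Bl t)) (ℕ.m^n>0 2 (K t))) (length-block (K t) (K t))

    block-size : ∀ t b m {e} → m ℕ.≤ 2 ℕ.^ e → suc (length (Bl t)) ℕ.^ b ℕ.* m ℕ.≤ 2 ℕ.^ (K (suc t) ℕ.* b ℕ.+ e)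
    block-size t b m {e} m≤ = begin
      suc (length (Bl t)) ℕ.^ b ℕ.* m          ≤⟨ ℕ.*-mono-≤ (ℕ.^-monoˡ-≤ b (1+length-Bl≤ t)) m≤ ⟩
      (2 ℕ.^ K (suc t)) ℕ.^ b ℕ.* 2 ℕ.^ e      ≡⟨ cong (ℕ._* 2 ℕ.^ e) (ℕ.^-*-assoc 2 (K (suc t)) b) ⟩
      2 ℕ.^ (K (suc t) ℕ.* b) ℕ.* 2 ℕ.^ e      ≡⟨ sym (ℕ.^-distribˡ-+-* 2 (K (suc t) ℕ.* b) e) ⟩
      2 ℕ.^ (K (suc t) ℕ.* b ℕ.+ e)            ∎
      where open ℕ.≤-Reasoning

    size-base : size (fullP base) ℕ.≤ 2 ℕ.^ (2 ℕ.^ w)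
    size-base = ℕ.≤-trans (ℕ.≤-reflexive (size-fullP base))
      (ℕ.^-monoʳ-≤ 2 (ℕ.≤-trans (length-primesIn 2 (2 ℕ.^ w ℕ.∸ 2)) (ℕ.m∸n≤m (2 ℕ.^ w) 2)))

    size-U : ∀ t j → size (U t j) ℕ.≤ 2 ℕ.^ sizeExp t j
    size-U zero    j = size-base
    size-U (suc t) j = ℕ.≤-trans (size-altP (depth j) (Bl t) (U t (suc j))) (block-size t (depth j) _ (size-U t (suc j)))

    -- A correction term raises the degree in one block only and continues with `U` below it. The
    -- topmost block is the worst place for this, whence one extra factor 2^(K t); the remaining
    -- factor 2 absorbs the sum of the two terms.
    size-L : ∀ t j → size (L t j) ℕ.≤ 2 ℕ.^ (sizeExp t j ℕ.+ suc (K t))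
    size-L zero    j = ℕ.≤-trans size-base (ℕ.^-monoʳ-≤ 2 (ℕ.m≤m+n (2 ℕ.^ w) (suc w)))
    size-L (suc t) j = begin
      size (altP b (Bl t) (L t (suc j))) ℕ.+ size (esymP (suc b) (Bl t) (U t (suc j)))
        ≤⟨ ℕ.+-mono-≤ (ℕ.≤-trans (size-altP b (Bl t) (L t (suc j))) (block-size t b _ (size-L t (suc j))))
                      (ℕ.≤-trans (size-esymP (suc b) (Bl t) (U t (suc j))) (block-size t (suc b) _ (size-U t (suc j)))) ⟩
      2 ℕ.^ (k ℕ.* b ℕ.+ (E ℕ.+ suc (K t))) ℕ.+ 2 ℕ.^ (k ℕ.* suc b ℕ.+ E)
        ≤⟨ ℕ.+-mono-≤ (ℕ.^-monoʳ-≤ 2 le₁) (ℕ.≤-reflexive (cong (2 ℕ.^_) eq₂)) ⟩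
      2 ℕ.^ (k ℕ.* b ℕ.+ E ℕ.+ k) ℕ.+ 2 ℕ.^ (k ℕ.* b ℕ.+ E ℕ.+ k)
        ≡⟨ 2^i+2^i (k ℕ.* b ℕ.+ E ℕ.+ k) ⟩
      2 ℕ.^ suc (k ℕ.* b ℕ.+ E ℕ.+ k)
        ≡⟨ cong (2 ℕ.^_) (sym (ℕ.+-suc (k ℕ.* b ℕ.+ E) k)) ⟩
      2 ℕ.^ (sizeExp (suc t) j ℕ.+ suc k) ∎
      where
        open ℕ.≤-Reasoning
        b = depth j
        k = K (suc t)
        E = sizeExp t (suc j)
        le₁ : k ℕ.* b ℕ.+ (E ℕ.+ suc (K t)) ℕ.≤ k ℕ.* b ℕ.+ E ℕ.+ k
        le₁ = ℕ.≤-trans (ℕ.≤-reflexive (sym (ℕ.+-assoc (k ℕ.* b) E _)))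
                (ℕ.+-monoʳ-≤ (k ℕ.* b ℕ.+ E) (ℕ.+-monoˡ-≤ (K t) (ℕ.≤-trans (ℕ.s≤s ℕ.z≤n) (40≤K t))))
        ident : ∀ k b E → k ℕ.* suc b ℕ.+ E ≡ k ℕ.* b ℕ.+ E ℕ.+ k
        ident = solve-∀
        eq₂ = ident k b E

    avoids-mono : ∀ {B B′ d} → B ℕ.≤ B′ → AvoidsBelow B′ d → AvoidsBelow B d
    avoids-mono B≤B′ av q pq q<B = av q pq (ℕ.<-≤-trans q<B B≤B′)

    avoids-∤ : ∀ {B d ps} → AvoidsBelow B d → All Prime ps → All (ℕ._< B) ps → All (_∤ d) ps
    avoids-∤ av prs lts = All.zipWith (λ (pp , lt) → av _ pp lt) (prs , lts)

    base-< : All (ℕ._< 2 ℕ.^ w) base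
    base-< = subst (λ z → All (ℕ._< z) base) (ℕ.m+[n∸m]≡n 2≤2^w) (primesIn-< 2 (2 ℕ.^ w ℕ.∸ 2))

    base-fresh : ∀ d → AvoidsBelow (2 ℕ.^ w) d → Fresh d (fullP base)
    base-fresh d av = fresh-fullP d prs (AllPairs.map ℕ.<⇒≢ (primesIn-sorted 2 (2 ℕ.^ w ℕ.∸ 2))) (avoids-∤ av prs base-<)
      where prs = primesIn-prime 2 (2 ℕ.^ w ℕ.∸ 2)

    Bl-∤ : ∀ t d → AvoidsBelow (2 ℕ.^ K (suc t)) d → All (_∤ d) (Bl t)
    Bl-∤ t d av = avoids-∤ av (block-prime (K t) (K t)) (block-< (K t) (K t))

    K-mono : ∀ t → 2 ℕ.^ K t ℕ.≤ 2 ℕ.^ K (suc t)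
    K-mono t = ℕ.^-monoʳ-≤ 2 (ℕ.m≤m+n (K t) (K t))

    fresh-U : ∀ t j d → AvoidsBelow (2 ℕ.^ K t) d → Fresh d (U t j)
    fresh-U zero    j d av = base-fresh d av
    fresh-U (suc t) j d av = fresh-altP (fresh-U t (suc j)) (depth j) d (block-prime (K t) (K t)) (block-≥ (K t) (K t))
      (block-distinct (K t) (K t)) (Bl-∤ t d av) (avoids-mono (K-mono t) av)

    fresh-L : ∀ t j d → AvoidsBelow (2 ℕ.^ K t) d → Fresh d (L t j)
    fresh-L zero    j d av = base-fresh d av
    fresh-L (suc t) j d av =
      fresh-altP (fresh-L t (suc j)) (depth j) d (block-prime (K t) (K t)) (block-≥ (K t) (K t))
        (block-distinct (K t) (K t)) (Bl-∤ t d av) (avoids-mono (K-mono t) av) ,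
      fresh-esymP (fresh-U t (suc j)) (suc (depth j)) d (block-prime (K t) (K t)) (block-≥ (K t) (K t))
        (block-distinct (K t) (K t)) (Bl-∤ t d av) (avoids-mono (K-mono t) av)

    avoids-1 : ∀ B → AvoidsBelow B 1
    avoids-1 B q pq _ q∣1 = contradiction (subst Prime (∣1⇒≡1 q∣1) pq) ¬prime[1]

    ∏-indicators : ∀ {r q ps} → q ∈ ps → q ∣ r → ∏1- (map (indicators r) ps) ≡ 0ℚ
    ∏-indicators {r} {q} {_ ∷ ps} (here refl) q∣r =
      trans (cong (λ z → (1ℚ - z) * ∏1- (map (indicators r) ps)) (ind-yes (q ∣? r) q∣r)) (*-zeroˡ (∏1- (map (indicators r) ps)))
    ∏-indicators {r} {q} {p ∷ ps} (there q∈) q∣r =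
      trans (cong ((1ℚ - [ p ∣ r ]) *_) (∏-indicators q∈ q∣r)) (*-zeroʳ (1ℚ - [ p ∣ r ]))

    -- The interval must outweigh the error divided by the mean value: the bound of `size-L`, then
    -- the reciprocal product of `∏-primesBelow≥`, and 2^6 from `scaled`.
    exponent : ℕ → ℕ
    exponent t = 6 ℕ.+ (sizeExp t 0 ℕ.+ suc (K t) ℕ.+ (w ℕ.+ 3 ℕ.* t))

    main-large : ∀ t → ι (size (L t 0)) + ι (size (L t 0)) < ι (2 ℕ.^ exponent t) * eval recip (L t 0)
    main-large t = begin-strict
      ι (size (L t 0)) + ι (size (L t 0))          ≤⟨ +-mono-≤ (ι-mono (size-L t 0)) (ι-mono (size-L t 0)) ⟩
      ι s + ι s                                    <⟨ scaled {s} {G} {eval recip (U t 0)} (ℕ.m^n>0 2 (sizeExp t 0 ℕ.+ suc (K t)))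
                                                        (≤-trans (∏-primesBelow≥ t) (*-monoˡ (0≤ι G) (∏≤U recip recip-Unit t 0))) (main≥ t 0) ⟩
      (ι 64 * (ι s * ι G)) * eval recip (L t 0)    ≡⟨ cong (_* eval recip (L t 0)) (sym (ι-pow (sizeExp t 0 ℕ.+ suc (K t)) (w ℕ.+ 3 ℕ.* t))) ⟩
      ι (2 ℕ.^ exponent t) * eval recip (L t 0)    ∎
      where
        open ≤-Reasoning
        s = 2 ℕ.^ (sizeExp t 0 ℕ.+ suc (K t))
        G = 2 ℕ.^ (w ℕ.+ 3 ℕ.* t)

    weighted : ℕ → ℕ → ℚ
    weighted t r = [ 1 ∣ r ] * eval (indicators r) (L t 0)

    -- At the indicators of r the full product vanishes as soon as one sieving prime divides r, and
    -- `L` lies below that product.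
    positive⇒avoids : ∀ t r → 0ℚ < weighted t r → AvoidsBelow (2 ℕ.^ K t) r
    positive⇒avoids t r pos q pq q< q∣r = <-irrefl refl (begin-strict
      0ℚ                                         <⟨ pos ⟩
      [ 1 ∣ r ] * eval (indicators r) (L t 0)    ≡⟨ cong (_* eval (indicators r) (L t 0)) (ind-yes (1 ∣? r) (1∣ r)) ⟩
      1ℚ * eval (indicators r) (L t 0)           ≡⟨ *-identityˡ (eval (indicators r) (L t 0)) ⟩
      eval (indicators r) (L t 0)                ≤⟨ L≤∏ (indicators r) (λ p → ind-Unit (p ∣? r)) t 0 ⟩
      ∏1- (map (indicators r) (primesBelow t))   ≡⟨ ∏-indicators (∈-primesBelow t pq q<) q∣r ⟩
      0ℚ                                         ∎)
      where open ≤-Reasoning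

    rough-in-interval : ∀ t a → ∃[ r ] a ℕ.≤ r × r ℕ.< 2 ℕ.^ exponent t ℕ.+ a × AvoidsBelow (2 ℕ.^ K t) r
    rough-in-interval t a =
      let r , a≤r , r< , pos = ∑<-increase (weighted t) a (2 ℕ.^ exponent t)
            (sum-grows (2 ℕ.^ exponent t) (λ x → ∑<-eval (L t 0) 1 x ℕ.≤-refl (fresh-L t 0 1 (avoids-1 (2 ℕ.^ K t)))) (main-large t) a)
      in r , a≤r , r< , positive⇒avoids t r pos

module Codes where

  open import Data.Nat
  open import Data.Nat.Properties
  open import Data.Nat.DivMod
  open import Data.Nat.Divisibility using (_∣_; divides; ∣⇒≤)
  open import Data.Nat.Tactic.RingSolver using (solve-∀)
  open import Data.Fin as Fin using (Fin; toℕ; fromℕ<; punchOut; remQuot; combine)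
  import Data.Fin.Properties as Fin
  open import Data.Fin.Permutation using (Permutation′; permutation; _⟨$⟩ʳ_; _≈_)
  open import Data.List using ([]; _∷_; length; filter; tabulate; lookup)
  open import Data.List.Properties using (filter-all; length-tabulate; lookup-tabulate)
  open import Data.List.Relation.Unary.All as All using ([]; _∷_)
  open import Data.List.Relation.Unary.AllPairs using ([]; _∷_)
  open import Data.List.Relation.Unary.Unique.Propositional using (Unique)
  open import Data.List.Relation.Unary.Unique.Propositional.Properties using (allFin⁺)
  open import Data.Product using (_×_; _,_; proj₁; proj₂; ∃-syntax)
  open import Data.Sum using (inj₁; inj₂)
  open import Function using (_∘_)
  open import Function.Definitions using (Injective)
  open import Relation.Nullary using (Dec; yes; no; ¬_; ¬?; contradiction)
  open import Relation.Unary using (Decidable)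
  open import Relation.Binary.Definitions using (tri<; tri≈; tri>)
  open import Relation.Binary.PropositionalEquality using (_≡_; _≢_; refl; sym; trans; cong; cong₂; subst; subst₂; module ≡-Reasoning)

  -- From injections to permutation codes.

  module _ {n : ℕ} (f : Fin n → Fin n) (f-inj : Injective _≡_ _≡_ f) where

    injective⇒surjective : ∀ y → ∃[ x ] f x ≡ y
    injective⇒surjective y with Fin.any? (λ x → f x Fin.≟ y)
    ... | yes hit = hit
    injective⇒surjective y@Fin.zero    | no miss = contradiction (Fin.injective⇒≤ {f = λ x → punchOut {i = y} (λ eq → miss (x , sym eq))}
      (f-inj ∘ Fin.punchOut-injective {i = y} _ _)) 1+n≰n
    injective⇒surjective y@(Fin.suc _) | no miss = contradiction (Fin.injective⇒≤ {f = λ x → punchOut {i = y} (λ eq → miss (x , sym eq))}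
      (f-inj ∘ Fin.punchOut-injective {i = y} _ _)) 1+n≰n

    injective⇒permutation : Permutation′ n
    injective⇒permutation = permutation f (proj₁ ∘ injective⇒surjective) (proj₂ ∘ injective⇒surjective)
      (λ x → f-inj (proj₂ (injective⇒surjective (f x))))

  module _ {n : ℕ} (f : ℕ → ℕ) (f< : ∀ {x} → x < n → f x < n)
           (f-inj : ∀ {x y} → x < n → y < n → f x ≡ f y → x ≡ y) where

    fromℕ-permutation : Permutation′ n
    fromℕ-permutation = injective⇒permutation (λ x → fromℕ< (f< (Fin.toℕ<n x)))
      (λ {x} {y} eq → Fin.toℕ-injective (f-inj (Fin.toℕ<n x) (Fin.toℕ<n y)
        (Fin.fromℕ<-injective _ _ (f< (Fin.toℕ<n x)) (f< (Fin.toℕ<n y)) eq)))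

    toℕ-permutation : ∀ x → toℕ (fromℕ-permutation ⟨$⟩ʳ x) ≡ f (toℕ x)
    toℕ-permutation x = Fin.toℕ-fromℕ< (f< (Fin.toℕ<n x))

  length-filter-¬≥ : ∀ {A : Set} {P : A → Set} (P? : Decidable P) → (∀ {x y} → P x → P y → x ≡ y) →
                     ∀ {xs} → Unique xs → length xs ≤ suc (length (filter (λ x → ¬? (P? x)) xs))
  length-filter-¬≥ P? uniq [] = z≤n
  length-filter-¬≥ P? uniq {x ∷ xs} (x∉ ∷ u) with P? x
  ... | yes Px = s≤s (≤-reflexive (cong length (sym (filter-all (λ y → ¬? (P? y)) (All.map (λ x≢y Py → x≢y (uniq Px Py)) x∉)))))
  ... | no ¬Px = s≤s (length-filter-¬≥ P? uniq u)

  hamming≥n∸1 : ∀ {n} (σ τ : Permutation′ n) → (∀ {x y} → σ ⟨$⟩ʳ x ≡ τ ⟨$⟩ʳ x → σ ⟨$⟩ʳ y ≡ τ ⟨$⟩ʳ y → x ≡ y) →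
                n ∸ 1 ≤ hamming σ τ
  hamming≥n∸1 {n} σ τ uniq = ∸-monoˡ-≤ 1 (≤-trans (≤-reflexive (sym (length-tabulate {n = n} (λ x → x))))
    (length-filter-¬≥ (λ x → (σ ⟨$⟩ʳ x) Fin.≟ (τ ⟨$⟩ʳ x)) uniq (allFin⁺ n)))

  family⇒M≥ : ∀ {n N} → 2 ≤ n → (σ : Fin N → Permutation′ n) →
              (∀ {i j} → i ≢ j → ∀ {x y} → σ i ⟨$⟩ʳ x ≡ σ j ⟨$⟩ʳ x → σ i ⟨$⟩ʳ y ≡ σ j ⟨$⟩ʳ y → x ≡ y) →
              M≥ n (n ∸ 1) N
  family⇒M≥ {n@(suc (suc _))} {N} (s≤s (s≤s _)) σ uniq = tabulate σ , code , ≤-reflexive (sym (length-tabulate σ))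
    where
      index : Fin (length (tabulate σ)) → Fin N
      index = Fin.cast (length-tabulate σ)
      lookup-index : ∀ i → lookup (tabulate σ) i ≡ σ (index i)
      lookup-index i = trans (cong (lookup (tabulate σ)) (sym (trans (Fin.cast-trans (length-tabulate σ) (sym (length-tabulate σ)) i) (Fin.cast-is-id refl i))))
                             (lookup-tabulate σ (index i))
      index-injective : ∀ {i j} → index i ≡ index j → i ≡ j
      index-injective {i} {j} eq = Fin.toℕ-injective (trans (sym (Fin.toℕ-cast (length-tabulate σ) i))
        (trans (cong toℕ eq) (Fin.toℕ-cast (length-tabulate σ) j)))
      code : IsPermCode n (n ∸ 1) (tabulate σ)
      code i j i≢j = subst₂ (λ ρ τ → ¬ (ρ ≈ τ) × hamming ρ τ ≥ n ∸ 1) (sym (lookup-index i)) (sym (lookup-index j))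
        -- Equal permutations would agree at the two positions 0 and 1; this is where 2 ≤ n enters.
        ( (λ same → contradiction (agree (same Fin.zero) (same (Fin.suc Fin.zero))) λ ())
        , hamming≥n∸1 (σ (index i)) (σ (index j)) agree)
        where agree = uniq (i≢j ∘ index-injective)

  -- Congruences modulo m.

  module _ {m : ℕ} .{{_ : NonZero m}} where

    %≡⇒∣ : ∀ {u v} → u % m ≡ v % m → m ∣ ∣ u - v ∣
    %≡⇒∣ {u} {v} eq = divides ∣ u / m - v / m ∣ (begin
      ∣ u - v ∣                                           ≡⟨ cong₂ ∣_-_∣ (m≡m%n+[m/n]*n u m) (m≡m%n+[m/n]*n v m) ⟩
      ∣ u % m + u / m * m - v % m + v / m * m ∣           ≡⟨ cong (λ z → ∣ u % m + u / m * m - z + v / m * m ∣) (sym eq) ⟩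
      ∣ u % m + u / m * m - u % m + v / m * m ∣           ≡⟨ ∣m+n-m+o∣≡∣n-o∣ (u % m) _ _ ⟩
      ∣ u / m * m - v / m * m ∣                           ≡⟨ sym (*-distribʳ-∣-∣ m (u / m) (v / m)) ⟩
      ∣ u / m - v / m ∣ * m                               ∎)
      where open ≡-Reasoning

    ∣∧<⇒≡0 : ∀ {g} → m ∣ g → g < m → g ≡ 0
    ∣∧<⇒≡0 {zero}  _   _   = refl
    ∣∧<⇒≡0 {suc g} m∣g g<m = contradiction g<m (≤⇒≯ (∣⇒≤ m∣g))

    +-cong-% : ∀ {u v u′ v′} → u % m ≡ v % m → u′ % m ≡ v′ % m → (u + u′) % m ≡ (v + v′) % m
    +-cong-% {u} {v} {u′} {v′} eq eq′ = begin
      (u + u′) % m             ≡⟨ %-distribˡ-+ u u′ m ⟩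
      (u % m + u′ % m) % m     ≡⟨ cong₂ (λ a b → (a + b) % m) eq eq′ ⟩
      (v % m + v′ % m) % m     ≡⟨ sym (%-distribˡ-+ v v′ m) ⟩
      (v + v′) % m             ∎
      where open ≡-Reasoning

    %-shift⇒∣ : ∀ z {w} → (z + w) % m ≡ z % m → m ∣ w
    %-shift⇒∣ z {w} eq = subst (m ∣_) (trans (cong (∣ z + w -_∣) (sym (+-identityʳ z))) (trans (∣m+n-m+o∣≡∣n-o∣ z w 0) (∣-∣-identityʳ w))) (%≡⇒∣ eq)

  -- Affine permutations of ℤ/m with k points moved to k new symbols

  module Extended (m k a b : ℕ) .{{_ : NonZero m}} (X : ℕ → ℕ)
                  (X< : ∀ {i} → i < k → X i < m)
                  (X-inj : ∀ {i j} → i < k → j < k → X i ≡ X j → i ≡ j)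
                  (affine-inj : ∀ {x y} → x < m → y < m → (a * x + b) % m ≡ (a * y + b) % m → x ≡ y) where

    affine : ℕ → ℕ
    affine x = (a * x + b) % m

    moved? : ∀ x → Dec (∃[ i ] i < k × X i ≡ x)
    moved? x = anyUpTo? (λ i → X i ≟ x) k

    σ : ℕ → ℕ
    σ x with x <? m | moved? x
    ... | yes _ | yes (i , _) = m + i
    ... | yes _ | no _        = affine x
    ... | no _  | _           = affine (X (x ∸ m))

    data View (x : ℕ) : Set where
      kept  : x < m → (∀ {i} → i < k → X i ≢ x) → σ x ≡ affine x → View x
      moved : ∀ i → i < k → x ≡ X i → σ x ≡ m + i → View x
      new   : ∀ i → i < k → x ≡ m + i → σ x ≡ affine (X i) → View x

    view : ∀ {x} → x < m + k → View x
    view {x} x<n with x <? m in eq₁ | moved? x in eq₂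
    ... | yes x<m | yes (i , i<k , refl) = moved i i<k refl (lem eq₁ eq₂)
      where
        lem : ∀ {p q} → (X i <? m) ≡ yes p → moved? (X i) ≡ yes (i , q) → σ (X i) ≡ m + i
        lem e₁ e₂ rewrite e₁ | e₂ = refl
    ... | yes x<m | no none = kept x<m (λ i<k eq → none (_ , i<k , eq)) (lem eq₁ eq₂)
      where
        lem : ∀ {p q} → (x <? m) ≡ yes p → moved? x ≡ no q → σ x ≡ affine x
        lem e₁ e₂ rewrite e₁ | e₂ = refl
    ... | no x≮m | _ = new (x ∸ m) (+-cancelˡ-< m _ _ (subst (_< m + k) (sym x≡) x<n)) (sym x≡) (lem eq₁)
      where
        x≡ : m + (x ∸ m) ≡ x
        x≡ = m+[n∸m]≡n (≮⇒≥ x≮m)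
        lem : ∀ {p} → (x <? m) ≡ no p → σ x ≡ affine (X (x ∸ m))
        lem e₁ rewrite e₁ = refl

    affine<m : ∀ x → affine x < m
    affine<m x = m%n<n (a * x + b) m

    affine≢new : ∀ x {i} → affine x ≢ m + i
    affine≢new x {i} eq = contradiction (subst (_< m) eq (affine<m x)) (m+n≮m m i)

    σ< : ∀ {x} → x < m + k → σ x < m + k
    σ< x< with view x<
    ... | kept _ _ eq    = subst (_< m + k) (sym eq) (<-≤-trans (affine<m _) (m≤m+n m k))
    ... | moved i i<k _ eq = subst (_< m + k) (sym eq) (+-monoʳ-< m i<k)
    ... | new _ _ _ eq   = subst (_< m + k) (sym eq) (<-≤-trans (affine<m _) (m≤m+n m k))

    σ-inj : ∀ {x y} → x < m + k → y < m + k → σ x ≡ σ y → x ≡ y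
    σ-inj {x} {y} x< y< eq with view x< | view y<
    ... | kept x<m _ e    | kept y<m _ e′      = affine-inj x<m y<m (trans (sym e) (trans eq e′))
    ... | kept _ _ e      | moved _ _ _ e′     = contradiction (trans (sym e) (trans eq e′)) (affine≢new x)
    ... | kept x<m ne e   | new i i<k _ e′     = contradiction (sym (affine-inj x<m (X< i<k) (trans (sym e) (trans eq e′)))) (ne i<k)
    ... | moved _ _ _ e   | kept _ _ e′        = contradiction (trans (sym e′) (trans (sym eq) e)) (affine≢new y)
    ... | moved i _ x≡ e  | moved j _ y≡ e′    = trans x≡ (trans (cong X (+-cancelˡ-≡ m i j (trans (sym e) (trans eq e′)))) (sym y≡))
    ... | moved _ _ _ e   | new j _ _ e′       = contradiction (trans (sym e′) (trans (sym eq) e)) (affine≢new (X j))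
    ... | new i i<k _ e   | kept y<m ne e′     = contradiction (affine-inj (X< i<k) y<m (trans (sym e) (trans eq e′))) (ne i<k)
    ... | new i _ _ e     | moved _ _ _ e′     = contradiction (trans (sym e) (trans eq e′)) (affine≢new (X i))
    ... | new i i<k x≡ e  | new j j<k y≡ e′    =
          trans x≡ (trans (cong (m +_) (X-inj i<k j<k (affine-inj (X< i<k) (X< j<k) (trans (sym e) (trans eq e′))))) (sym y≡))

  -- Subtraction-free form of the fact that the difference of two lines changes by d g between x and
  -- x + g. If the lines meet at both places, then d g vanishes modulo m.
  cross-identity : ∀ a d b b′ x g →
    ((a + d) * (x + g) + b′) + (a * x + b) ≡ ((a * (x + g) + b) + ((a + d) * x + b′)) + d * g
  cross-identity = solve-∀

  -- The line of slope A + 1 + e determined by (e, α, φ) gives up its k cells (X i, Y i), where X i and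
  -- Y i stay in the e-th arc of length l; X i is sent to the new symbol m + i and the new
  -- position m + i to Y i.  Lines of different slopes use different arcs, so they agree only at
  -- their intersection; parallel lines agree only at new cells.
  module Construction (m k A Φ l : ℕ) .{{_ : NonZero m}} (1≤A : 1 ≤ A)
    -- An arc has to hold φ < Φ, the displacement `shift * suc α` and the rise
    -- `slope * (suc α * i)`, the last two at most 2 A² (k + 1) each. One l and 2 A more in
    -- `m-large` keep the compared quantities in `parallel-equal` below m.
    (l-large : Φ + 4 * (A * A * suc k) ≤ l) (m-large : suc (A + A) * l ≤ m)
    (cancel : ∀ {d g} → 1 ≤ d → d ≤ A + A → m ∣ d * g → m ∣ g) where

    record Param : Set where
      constructor param
      field
        e α φ : ℕ
        e<A   : e < A
        α<A   : α < A
        φ<Φ   : φ < Φ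

    open Param

    module _ (p : Param) where

      -- b stands for y₀ - slope · x₀ modulo m. Put c = slope - 1 = A + e. The value 1 + c k of
      -- `shift` serves two ends: it is 1 modulo c, so that α < A ≤ c can be read off the intercept,
      -- and it exceeds every i < k, so that two parallel lines cannot collide both in a moved
      -- position and in a new one.
      slope shift x₀ y₀ b : ℕ
      slope = suc (A + e p)
      shift = suc ((A + e p) * k)
      x₀ = e p * l + φ p
      y₀ = e p * l + (φ p + shift * suc (α p))
      b = y₀ + slope * (m ∸ x₀)

      X Y : ℕ → ℕ
      X i = x₀ + suc (α p) * i
      Y i = y₀ + slope * (suc (α p) * i)

      slope≤ : slope ≤ A + A
      slope≤ = subst (_≤ A + A) (+-suc A (e p)) (+-monoʳ-≤ A (e<A p))

      private
        Q = A * A * suc k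

        αi≤ : ∀ {i} → i ≤ k → suc (α p) * i ≤ A * suc k
        αi≤ i≤k = *-mono-≤ (α<A p) (m≤n⇒m≤1+n i≤k)

        ask≤Q : A * suc k ≤ Q
        ask≤Q = *-monoˡ-≤ (suc k) (m≤m*n A A {{>-nonZero 1≤A}})

        shift≤ : shift * suc (α p) ≤ 2 * Q
        shift≤ = begin
          suc ((A + e p) * k) * suc (α p)     ≤⟨ *-mono-≤ (+-mono-≤ (≤-trans 1≤A (m≤m+n A A)) (*-monoˡ-≤ k (+-monoʳ-≤ A (<⇒≤ (e<A p))))) (α<A p) ⟩
          ((A + A) + (A + A) * k) * A         ≡⟨ ident A k ⟩
          2 * (A * A * suc k)                 ∎
          where open ≤-Reasoning
                ident : ∀ A k → ((A + A) + (A + A) * k) * A ≡ 2 * (A * A * suc k)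
                ident = solve-∀

        slopeαi≤ : ∀ {i} → i ≤ k → slope * (suc (α p) * i) ≤ 2 * Q
        slopeαi≤ i≤k = ≤-trans (*-mono-≤ slope≤ (αi≤ i≤k)) (≤-reflexive (ident A k))
          where ident : ∀ A k → (A + A) * (A * suc k) ≡ 2 * (A * A * suc k)
                ident = solve-∀

      offsetX< : ∀ {i} → i ≤ k → φ p + suc (α p) * i < l
      offsetX< i≤k = <-≤-trans (+-mono-<-≤ (φ<Φ p) (≤-trans (αi≤ i≤k) (≤-trans ask≤Q (m≤m+n Q (3 * Q))))) l-large

      offsetY< : ∀ {i} → i ≤ k → φ p + shift * suc (α p) + slope * (suc (α p) * i) < l
      offsetY< i≤k = <-≤-trans (+-mono-<-≤ (+-mono-<-≤ (φ<Φ p) shift≤) (slopeαi≤ i≤k)) (≤-trans (≤-reflexive (ident Φ Q)) l-large)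
        where ident : ∀ Φ Q → Φ + 2 * Q + 2 * Q ≡ Φ + 4 * Q
              ident = solve-∀

      arc : ∀ {f} → f < l → e p * l + f < suc (e p) * l
      arc {f} f<l = subst (e p * l + f <_) (+-comm (e p * l) l) (+-monoʳ-< (e p * l) f<l)

      arc<m : ∀ {f} → f < l → e p * l + f < m
      arc<m f<l = <-≤-trans (arc f<l) (≤-trans (*-monoˡ-≤ l (≤-trans (e<A p) (≤-trans (m≤m+n A A) (n≤1+n _)))) m-large)

      X-arc : ∀ i → X i ≡ e p * l + (φ p + suc (α p) * i)
      X-arc i = +-assoc (e p * l) (φ p) _

      Y-arc : ∀ i → Y i ≡ e p * l + (φ p + shift * suc (α p) + slope * (suc (α p) * i))
      Y-arc i = +-assoc (e p * l) (φ p + shift * suc (α p)) _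

      X<m : ∀ {i} → i ≤ k → X i < m
      X<m {i} i≤k = subst (_< m) (sym (X-arc i)) (arc<m (offsetX< i≤k))

      Y<m : ∀ {i} → i ≤ k → Y i < m
      Y<m {i} i≤k = subst (_< m) (sym (Y-arc i)) (arc<m (offsetY< i≤k))

      x₀≤m : x₀ ≤ m
      x₀≤m = <⇒≤ (subst (_< m) (trans (cong (x₀ +_) (*-zeroʳ (suc (α p)))) (+-identityʳ x₀)) (X<m z≤n))

      X-inj : ∀ {i j} → i < k → j < k → X i ≡ X j → i ≡ j
      X-inj {i} {j} _ _ eq = *-cancelˡ-≡ i j (suc (α p)) (+-cancelˡ-≡ x₀ _ _ eq)

      affine-X : ∀ {i} → i ≤ k → (slope * X i + b) % m ≡ Y i
      affine-X {i} i≤k = begin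
        (slope * (x₀ + t) + (y₀ + slope * (m ∸ x₀))) % m     ≡⟨ cong (_% m) (ident slope x₀ t y₀ (m ∸ x₀)) ⟩
        (y₀ + slope * t + slope * (x₀ + (m ∸ x₀))) % m       ≡⟨ cong (λ z → (y₀ + slope * t + slope * z) % m) (m+[n∸m]≡n x₀≤m) ⟩
        (Y i + slope * m) % m                                ≡⟨ [m+kn]%n≡m%n (Y i) slope m ⟩
        Y i % m                                              ≡⟨ m<n⇒m%n≡m (Y<m i≤k) ⟩
        Y i                                                  ∎
        where
          open ≡-Reasoning
          t = suc (α p) * i
          ident : ∀ a x t y r → a * (x + t) + (y + a * r) ≡ y + a * t + a * (x + r)
          ident = solve-∀

      affine-inj-≤ : ∀ {x y} → x ≤ y → y < m → (slope * y + b) % m ≡ (slope * x + b) % m → y ≡ x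
      affine-inj-≤ {x} {y} x≤y y<m eq = trans (sym (m+[n∸m]≡n x≤y)) (trans (cong (x +_) g≡0) (+-identityʳ x))
        where
          ident : ∀ a x g b → a * (x + g) + b ≡ (a * x + b) + a * g
          ident = solve-∀
          g≡0 : y ∸ x ≡ 0
          g≡0 = ∣∧<⇒≡0 (cancel (s≤s z≤n) slope≤ (%-shift⇒∣ (slope * x + b)
                  (trans (cong (_% m) (trans (sym (ident slope x (y ∸ x) b)) (cong (λ z → slope * z + b) (m+[n∸m]≡n x≤y)))) eq)))
                  (≤-<-trans (m∸n≤m y x) y<m)

      affine-inj : ∀ {x y} → x < m → y < m → (slope * x + b) % m ≡ (slope * y + b) % m → x ≡ y
      affine-inj {x} {y} x<m y<m eq with ≤-total x y
      ... | inj₁ x≤y = sym (affine-inj-≤ x≤y y<m (sym eq))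
      ... | inj₂ y≤x = affine-inj-≤ y≤x x<m eq

      module E = Extended m k slope b X (X<m ∘ <⇒≤) X-inj affine-inj

    data Agree (p q : Param) (x : ℕ) : Set where
      kept  : x < m → (slope p * x + b p) % m ≡ (slope q * x + b q) % m → Agree p q x
      moved : ∀ i → i < k → x ≡ X p i → X p i ≡ X q i → Agree p q x
      new   : ∀ i → i < k → x ≡ m + i → Y p i ≡ Y q i → Agree p q x

    Agree-sym : ∀ {p q x} → Agree p q x → Agree q p x
    Agree-sym (kept x<m eq)        = kept x<m (sym eq)
    Agree-sym (moved i i<k x≡ eq)  = moved i i<k (trans x≡ eq) (sym eq)
    Agree-sym (new i i<k x≡ eq)    = new i i<k x≡ (sym eq)

    -- The kind of a point is visible from outside: new points are the positions from m on, moved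
    -- points are the old positions whose symbol is at least m. Both permutations must therefore
    -- treat x in the same way.
    agree : ∀ p q {x} → x < m + k → E.σ p x ≡ E.σ q x → Agree p q x
    agree p q {x} x< eq with E.view p x< | E.view q x<
    ... | E.kept x<m _ e       | E.kept _ _ e′        = kept x<m (trans (sym e) (trans eq e′))
    ... | E.kept _ _ e         | E.moved _ _ _ e′     = contradiction (trans (sym e) (trans eq e′)) (E.affine≢new p x)
    ... | E.kept x<m _ _       | E.new i _ x≡ _       = contradiction (subst (_< m) x≡ x<m) (m+n≮m m i)
    ... | E.moved _ _ _ e      | E.kept _ _ e′        = contradiction (trans (sym e′) (trans (sym eq) e)) (E.affine≢new q x)
    ... | E.moved i i<k x≡ e   | E.moved j _ x≡′ e′   = moved i i<k x≡ (trans (sym x≡) (trans x≡′ (cong (X q) (sym (+-cancelˡ-≡ m i j (trans (sym e) (trans eq e′)))))))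
    ... | E.moved _ _ _ e      | E.new j _ _ e′       = contradiction (trans (sym e′) (trans (sym eq) e)) (E.affine≢new q (X q j))
    ... | E.new i _ x≡ _       | E.kept x<m _ _       = contradiction (subst (_< m) x≡ x<m) (m+n≮m m i)
    ... | E.new i _ _ e        | E.moved _ _ _ e′     = contradiction (trans (sym e) (trans eq e′)) (E.affine≢new p (X p i))
    ... | E.new i i<k x≡ e     | E.new j j<k x≡′ e′   = new i i<k x≡ (trans (sym (affine-X p (<⇒≤ i<k)))
          (trans (sym e) (trans eq (trans e′ (trans (affine-X q (<⇒≤ j<k)) (cong (Y q) (sym (+-cancelˡ-≡ m i j (trans (sym x≡) x≡′)))))))))

    arcs-disjoint : ∀ p q {f g} → e p < e q → f < l → e p * l + f ≢ e q * l + g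
    arcs-disjoint p q {f} {g} e< f<l eq = <⇒≢ (<-≤-trans (arc p f<l) (≤-trans (*-monoˡ-≤ l e<) (m≤m+n (e q * l) g))) eq

    kept-unique-≤ : ∀ p q {x y} → e p < e q → x ≤ y → y < m →
      (slope p * x + b p) % m ≡ (slope q * x + b q) % m → (slope p * y + b p) % m ≡ (slope q * y + b q) % m → x ≡ y
    kept-unique-≤ p q {x} {y} e< x≤y y<m eqx eqy = trans (sym (+-identityʳ x)) (trans (cong (x +_) (sym g≡0)) (m+[n∸m]≡n x≤y))
      where
        d = e q ∸ e p
        g = y ∸ x
        a = slope p
        slopes : slope q ≡ a + d
        slopes = cong suc (trans (cong (A +_) (sym (m+[n∸m]≡n (<⇒≤ e<)))) (sym (+-assoc A (e p) d)))
        eqx′ : (a * x + b p) % m ≡ ((a + d) * x + b q) % m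
        eqx′ = subst (λ s → (a * x + b p) % m ≡ (s * x + b q) % m) slopes eqx
        eqy′ : (a * (x + g) + b p) % m ≡ ((a + d) * (x + g) + b q) % m
        eqy′ = subst₂ (λ s z → (a * z + b p) % m ≡ (s * z + b q) % m) slopes (sym (m+[n∸m]≡n x≤y)) eqy
        m∣dg : m ∣ d * g
        m∣dg = %-shift⇒∣ ((a * (x + g) + b p) + ((a + d) * x + b q))
                 (trans (cong (_% m) (sym (cross-identity a d (b p) (b q) x g))) (+-cong-% (sym eqy′) eqx′))
        g≡0 : g ≡ 0
        g≡0 = ∣∧<⇒≡0 (cancel (m<n⇒0<n∸m e<) (≤-trans (m∸n≤m (e q) (e p)) (≤-trans (<⇒≤ (e<A q)) (m≤m+n A A))) m∣dg)
                (≤-<-trans (m∸n≤m y x) y<m)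

    unique-< : ∀ p q → e p < e q → ∀ {x y} → Agree p q x → Agree p q y → x ≡ y
    unique-< p q e< (moved i i<k _ eq) _ = contradiction (trans (sym (X-arc p i)) (trans eq (X-arc q i))) (arcs-disjoint p q e< (offsetX< p (<⇒≤ i<k)))
    unique-< p q e< (new i i<k _ eq)   _ = contradiction (trans (sym (Y-arc p i)) (trans eq (Y-arc q i))) (arcs-disjoint p q e< (offsetY< p (<⇒≤ i<k)))
    unique-< p q e< _ (moved i i<k _ eq) = contradiction (trans (sym (X-arc p i)) (trans eq (X-arc q i))) (arcs-disjoint p q e< (offsetX< p (<⇒≤ i<k)))
    unique-< p q e< _ (new i i<k _ eq)   = contradiction (trans (sym (Y-arc p i)) (trans eq (Y-arc q i))) (arcs-disjoint p q e< (offsetY< p (<⇒≤ i<k)))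
    unique-< p q e< {x} {y} (kept x<m eqx) (kept y<m eqy) with ≤-total x y
    ... | inj₁ x≤y = kept-unique-≤ p q e< x≤y y<m eqx eqy
    ... | inj₂ y≤x = sym (kept-unique-≤ p q e< y≤x x<m eqy eqx)

    -- Up to a term depending only on e, the intercept is shift · (α + 1) - c φ modulo m. With the
    -- φ-terms carried across, both sides lie in [0, m), so the congruence is an equality of
    -- numbers; modulo c it gives α, and then φ.
    parallel-equal : ∀ p q → e p ≡ e q → ∀ x → (slope p * x + b p) % m ≡ (slope q * x + b q) % m → α p ≡ α q × φ p ≡ φ q
    parallel-equal p q refl x eq = α≡ , sym φ≡
      where
        a = slope p
        c = A + e p
        el = e p * l
        u = φ p + shift p * suc (α p) + a * φ q
        v = φ q + shift p * suc (α q) + a * φ p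
        C = a * m + a * el + el
        -- Added to both intercepts, this completes each `m ∸ x₀` to m and removes the truncated
        -- subtraction.
        Z = a * x₀ p + a * x₀ q
        ident : ∀ a el φ φ′ h r → (a * (el + φ) + a * (el + φ′)) + (el + (φ + h) + a * r) ≡ (a * (el + φ + r) + a * el + el) + (φ + h + a * φ′)
        ident = solve-∀
        Zb : ∀ p q → e p ≡ e q → slope p * x₀ p + slope p * x₀ q + b p ≡ slope p * m + slope p * (e p * l) + e p * l + (φ p + shift p * suc (α p) + slope p * φ q)
        Zb p q refl = trans (ident (slope p) (e p * l) (φ p) (φ q) (shift p * suc (α p)) (m ∸ x₀ p))
          (cong (λ z → (slope p * z + slope p * (e p * l) + e p * l) + (φ p + shift p * suc (α p) + slope p * φ q)) (m+[n∸m]≡n (x₀≤m p)))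
        dist : ∣ a * x + b p - a * x + b q ∣ ≡ ∣ u - v ∣
        dist = begin
          ∣ a * x + b p - a * x + b q ∣  ≡⟨ ∣m+n-m+o∣≡∣n-o∣ (a * x) (b p) (b q) ⟩
          ∣ b p - b q ∣                  ≡⟨ sym (∣m+n-m+o∣≡∣n-o∣ Z (b p) (b q)) ⟩
          ∣ Z + b p - Z + b q ∣          ≡⟨ cong₂ ∣_-_∣ (Zb p q refl) (trans (cong (_+ b q) (+-comm (a * x₀ p) (a * x₀ q))) (Zb q p refl)) ⟩
          ∣ C + u - C + v ∣              ≡⟨ ∣m+n-m+o∣≡∣n-o∣ C u v ⟩
          ∣ u - v ∣                      ∎
          where open ≡-Reasoning
        small : ∀ p q → φ p + shift p * suc (α p) + slope p * φ q < m
        small p q = <-≤-trans (+-mono-<-≤ (≤-<-trans (m≤m+n (φ p + shift p * suc (α p)) (slope p * (suc (α p) * 0))) (offsetY< p {0} z≤n))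
          (*-mono-≤ (slope≤ p) (≤-trans (<⇒≤ (φ<Φ q)) (≤-trans (m≤m+n Φ _) l-large)))) m-large
        u≡v : u ≡ v
        u≡v = ∣m-n∣≡0⇒m≡n (∣∧<⇒≡0 (subst (m ∣_) dist (%≡⇒∣ eq)) (≤-<-trans (∣m-n∣≤m⊔n u v) (⊔-lub (small p q) (small q p))))
        ident₂ : ∀ c k φ φ′ α → φ + suc (c * k) * suc α + suc c * φ′ ≡ suc (φ + φ′) + (α + (k * suc α + φ′) * c)
        ident₂ = solve-∀
        reduced : α p + (k * suc (α p) + φ q) * c ≡ α q + (k * suc (α q) + φ p) * c
        reduced = +-cancelˡ-≡ (suc (φ p + φ q)) _ _ (trans (sym (ident₂ c k (φ p) (φ q) (α p)))
          (trans u≡v (trans (ident₂ c k (φ q) (φ p) (α q)) (cong (λ z → suc z + (α q + (k * suc (α q) + φ p) * c)) (+-comm (φ q) (φ p))))))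
        instance _ = >-nonZero (≤-trans 1≤A (m≤m+n A (e p)))
        α≡ : α p ≡ α q
        α≡ = begin
          α p                                            ≡⟨ sym (m<n⇒m%n≡m (<-≤-trans (α<A p) (m≤m+n A (e p)))) ⟩
          α p % c                                        ≡⟨ sym ([m+kn]%n≡m%n (α p) (k * suc (α p) + φ q) c) ⟩
          (α p + (k * suc (α p) + φ q) * c) % c          ≡⟨ cong (_% c) reduced ⟩
          (α q + (k * suc (α q) + φ p) * c) % c          ≡⟨ [m+kn]%n≡m%n (α q) (k * suc (α q) + φ p) c ⟩
          α q % c                                        ≡⟨ m<n⇒m%n≡m (<-≤-trans (α<A q) (m≤m+n A (e p))) ⟩
          α q                                            ∎
          where open ≡-Reasoning
        φ≡ : φ q ≡ φ p
        φ≡ = +-cancelˡ-≡ (k * suc (α q)) _ _ (*-cancelʳ-≡ _ _ c (+-cancelˡ-≡ (α q) _ _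
               (subst (λ z → z + (k * suc z + φ q) * c ≡ α q + (k * suc (α q) + φ p) * c) α≡ reduced)))

    module _ (p q : Param) (e≡ : e p ≡ e q) (α< : α q < α p) where

      private
        δ = α p ∸ α q
        instance _ = >-nonZero (m<n⇒0<n∸m α<)
        α≡ : suc (α p) ≡ suc (α q) + δ
        α≡ = cong suc (sym (m+[n∸m]≡n (<⇒≤ α<)))

      -- Every collision of two parallel lines solves φ p + δ z = φ q, which has at most one
      -- solution z. A moved point gives z = i < k; by `new-gap` a new point gives z = shift + slope
      -- · j.
      moved-gap : ∀ i → X p i ≡ X q i → φ p + δ * i ≡ φ q
      moved-gap i eq = +-cancelˡ-≡ (suc (α q) * i) _ _ (trans (ident (α q) i (φ p) δ)
        (trans (cong (λ z → φ p + z * i) (sym α≡)) (trans off (+-comm (φ q) _))))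
        where
          ident : ∀ α i φ δ → suc α * i + (φ + δ * i) ≡ φ + (suc α + δ) * i
          ident = solve-∀
          off : φ p + suc (α p) * i ≡ φ q + suc (α q) * i
          off = +-cancelˡ-≡ (e p * l) _ _ (trans (sym (X-arc p i)) (trans eq (trans (X-arc q i) (cong (λ z → z * l + (φ q + suc (α q) * i)) (sym e≡)))))

      new-gap : ∀ j → Y p j ≡ Y q j → φ p + δ * (shift p + slope p * j) ≡ φ q
      new-gap j eq = +-cancelˡ-≡ (h * suc (α q) + a * (suc (α q) * j)) _ _ (trans (ident h a (α q) j (φ p) δ)
        (trans (cong (λ z → φ p + h * z + a * (z * j)) (sym α≡)) (trans off (trans (+-assoc (φ q) _ _) (+-comm (φ q) _)))))
        where
          h = shift p
          a = slope p
          ident : ∀ h a α j φ δ → (h * suc α + a * (suc α * j)) + (φ + δ * (h + a * j)) ≡ φ + h * (suc α + δ) + a * ((suc α + δ) * j)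
          ident = solve-∀
          off : φ p + h * suc (α p) + a * (suc (α p) * j) ≡ φ q + h * suc (α q) + a * (suc (α q) * j)
          off = +-cancelˡ-≡ (e p * l) _ _ (trans (sym (Y-arc p j)) (trans eq (trans (Y-arc q j)
            (cong (λ z → z * l + (φ q + suc ((A + z) * k) * suc (α q) + suc (A + z) * (suc (α q) * j))) (sym e≡)))))

      cancel-gap : ∀ {s t} → φ p + δ * s ≡ φ q → φ p + δ * t ≡ φ q → s ≡ t
      cancel-gap {s} {t} es et = *-cancelˡ-≡ s t δ (+-cancelˡ-≡ (φ p) _ _ (trans es (sym et)))

      -- The shift exceeds every i < k.
      moved-new-⊥ : ∀ {i j} → i < k → X p i ≡ X q i → Y p j ≢ Y q j
      moved-new-⊥ {i} {j} i<k eqX eqY = <⇒≢ (<-≤-trans (<-≤-trans i<k (≤-trans (m≤n*m k (A + e p) {{>-nonZero (≤-trans 1≤A (m≤m+n A (e p)))}}) (n≤1+n _))) (m≤m+n (shift p) (slope p * j)))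
        (cancel-gap (moved-gap i eqX) (new-gap j eqY))

      unique-≡< : ∀ {x y} → Agree p q x → Agree p q y → x ≡ y
      unique-≡< {x} (kept _ eq) _ = contradiction (sym (proj₁ (parallel-equal p q e≡ x eq))) (<⇒≢ α<)
      unique-≡< {y = y} _ (kept _ eq) = contradiction (sym (proj₁ (parallel-equal p q e≡ y eq))) (<⇒≢ α<)
      unique-≡< (moved i _ x≡ eq) (moved j _ y≡ eq′) = trans x≡ (trans (cong (X p) (cancel-gap (moved-gap i eq) (moved-gap j eq′))) (sym y≡))
      unique-≡< (moved _ i<k _ eq) (new _ _ _ eq′) = contradiction eq′ (moved-new-⊥ i<k eq)
      unique-≡< (new _ _ _ eq) (moved _ i<k _ eq′) = contradiction eq (moved-new-⊥ i<k eq′)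
      unique-≡< (new i _ x≡ eq) (new j _ y≡ eq′) = trans x≡ (trans (cong (m +_)
        (*-cancelˡ-≡ i j (slope p) (+-cancelˡ-≡ (shift p) _ _ (cancel-gap (new-gap i eq) (new-gap j eq′))))) (sym y≡))

    agree⇒φ≡ : ∀ p q → e p ≡ e q → α p ≡ α q → ∀ {x} → Agree p q x → φ p ≡ φ q
    agree⇒φ≡ p q e≡ α≡ {x} (kept _ eq)      = proj₂ (parallel-equal p q e≡ x eq)
    agree⇒φ≡ p q refl refl (moved i _ _ eq) = +-cancelˡ-≡ (e p * l) _ _ (+-cancelʳ-≡ (suc (α p) * i) _ _ eq)
    agree⇒φ≡ p q refl refl (new i _ _ eq)   = +-cancelʳ-≡ (shift p * suc (α p)) _ _ (+-cancelˡ-≡ (e p * l) _ _ (+-cancelʳ-≡ (slope p * (suc (α p) * i)) _ _ eq))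

    unique : ∀ p q → ¬ (e p ≡ e q × α p ≡ α q × φ p ≡ φ q) → ∀ {x y} → Agree p q x → Agree p q y → x ≡ y
    unique p q p≢q ax ay with <-cmp (e p) (e q)
    ... | tri< e< _ _ = unique-< p q e< ax ay
    ... | tri> _ _ e> = unique-< q p e> (Agree-sym ax) (Agree-sym ay)
    ... | tri≈ _ e≡ _ with <-cmp (α p) (α q)
    ...   | tri< α< _ _ = unique-≡< q p (sym e≡) α< (Agree-sym ax) (Agree-sym ay)
    ...   | tri> _ _ α> = unique-≡< p q e≡ α> ax ay
    ...   | tri≈ _ α≡ _ = contradiction (e≡ , α≡ , agree⇒φ≡ p q e≡ α≡ ax) p≢q

    decode : Fin (A * (A * Φ)) → Param
    decode i = param (toℕ e′) (toℕ α′) (toℕ φ′) (Fin.toℕ<n e′) (Fin.toℕ<n α′) (Fin.toℕ<n φ′)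
      where
        r = remQuot {A} (A * Φ) i
        e′ = proj₁ r
        α′ = proj₁ (remQuot {A} Φ (proj₂ r))
        φ′ = proj₂ (remQuot {A} Φ (proj₂ r))

    remQuot-injective : ∀ {c} d {i j : Fin (c * d)} → proj₁ (remQuot {c} d i) ≡ proj₁ (remQuot {c} d j) → proj₂ (remQuot {c} d i) ≡ proj₂ (remQuot {c} d j) → i ≡ j
    remQuot-injective {c} d {i} {j} eq₁ eq₂ = trans (sym (Fin.combine-remQuot {c} d i)) (trans (cong₂ combine eq₁ eq₂) (Fin.combine-remQuot {c} d j))

    decode-injective : ∀ {i j} → e (decode i) ≡ e (decode j) × α (decode i) ≡ α (decode j) × φ (decode i) ≡ φ (decode j) → i ≡ j
    decode-injective (e≡ , α≡ , φ≡) = remQuot-injective {A} (A * Φ) (Fin.toℕ-injective e≡)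
      (remQuot-injective {A} Φ (Fin.toℕ-injective α≡) (Fin.toℕ-injective φ≡))

    perm : Param → Permutation′ (m + k)
    perm p = fromℕ-permutation (E.σ p) (E.σ< p) (E.σ-inj p)

    code : 2 ≤ m + k → M≥ (m + k) (m + k ∸ 1) (A * (A * Φ))
    code 2≤n = family⇒M≥ 2≤n (perm ∘ decode) λ {i} {j} i≢j {x} {y} eqx eqy →
      Fin.toℕ-injective (unique (decode i) (decode j) (i≢j ∘ decode-injective) (toAgree i j x eqx) (toAgree i j y eqy))
      where
        toAgree : ∀ i j x → perm (decode i) ⟨$⟩ʳ x ≡ perm (decode j) ⟨$⟩ʳ x → Agree (decode i) (decode j) (toℕ x)
        toAgree i j x eq = agree (decode i) (decode j) (Fin.toℕ<n x)
          (trans (sym (toℕ-permutation (E.σ p) (E.σ< p) (E.σ-inj p) x)) (trans (cong toℕ eq) (toℕ-permutation (E.σ q) (E.σ< q) (E.σ-inj q) x)))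
          where p = decode i
                q = decode j

module Exponents where

  open import Data.Nat
  open import Data.Nat.Properties
  open import Data.Nat.DivMod using (_/_; _%_; m/n*n≤m; m%n<n; m≡m%n+[m/n]*n)
  open import Data.Nat.Divisibility using (_∣_; divides; ∣-trans; ∣⇒≤; m∣m*n)
  open import Data.Nat.Coprimality using (Coprime; coprime-divisor)
  open import Data.Nat.Induction using (<-rec)
  open import Data.Nat.Primality using (Prime)
  open import Data.Nat.Primality.Factorisation using (factorise)
  open import Data.Nat.Tactic.RingSolver using (solve-∀)
  open import Data.List using ([]; _∷_)
  open import Data.List.Relation.Unary.All using ([]; _∷_)
  open import Data.Product using (Σ; _×_; _,_; ∃-syntax)
  open import Relation.Nullary using (yes; no; contradiction)
  open import Relation.Binary.PropositionalEquality using (_≡_; refl; sym; ≢-sym; trans; cong; cong₂; subst)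
  open RoughNumbers using (double; AvoidsBelow; 2^-cancel-≤; 2^i+2^i; depth; scale; module Sieve)
  open Codes using (module Construction)

  -- Coprimality to a rough number.

  prime-divisor : ∀ n → 2 ≤ n → ∃[ q ] Prime q × q ∣ n
  prime-divisor n 2≤n with factorise n {{>-nonZero (<⇒≤ 2≤n)}}
  ... | record { factors = [] ; isFactorisation = eq } = contradiction (subst (2 ≤_) eq 2≤n) λ { (s≤s ()) }
  ... | record { factors = q ∷ qs ; isFactorisation = eq ; factorsPrime = pq ∷ _ } = q , pq , subst (q ∣_) (sym eq) (m∣m*n _)

  avoids⇒coprime : ∀ {z m d} → AvoidsBelow z m → 1 ≤ d → d < z → Coprime m d
  avoids⇒coprime av 1≤d d<z {zero}  (_ , divides q eq) = contradiction (trans eq (*-zeroʳ q)) (≢-sym (<⇒≢ 1≤d))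
  avoids⇒coprime av 1≤d d<z {suc zero} _ = refl
  avoids⇒coprime av 1≤d d<z {i@(suc (suc _))} (i∣m , i∣d) =
    let q , pq , q∣i = prime-divisor i (s≤s (s≤s z≤n))
    in contradiction (∣-trans q∣i i∣m) (av q pq (≤-<-trans (∣⇒≤ {{>-nonZero 1≤d}} (∣-trans q∣i i∣d)) d<z))

  double≡ : ∀ c → double c ≡ 2 * c
  double≡ zero    = refl
  double≡ (suc c) = trans (cong (λ z → suc (suc z)) (double≡ c)) (sym (*-distribˡ-+ 2 1 c))

  -- rate j / 4 is the exponent of 2^K contributed by the blocks j, j + 1, … to the number of monomials.
  rate : ℕ → ℕ
  rate 0 = 33
  rate 1 = 34
  rate 2 = 36
  rate 3 = 40
  rate (suc (suc (suc (suc u)))) = 48 + 16 * u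

  -- The scale halves from each block to the next one down, so rate j = 4 · (depth j + depth (j +
  -- 1)/2 + depth (j + 2)/4 + ⋯). At j = 0 this is 4 · (31/4 + 6/32 + 8/64 + ⋯) = 33.
  rate-step : ∀ j → 8 * depth j + rate (suc j) ≡ 2 * rate j
  rate-step 0 = refl
  rate-step 1 = refl
  rate-step 2 = refl
  rate-step 3 = refl
  rate-step (suc (suc (suc (suc u)))) = trans (cong (λ z → 8 * (4 + z) + (48 + 16 * suc u)) (double≡ u)) (ident u)
    where ident : ∀ u → 8 * (4 + 2 * u) + (48 + 16 * suc u) ≡ 2 * (48 + 16 * u)
          ident = solve-∀

  scale≡ : ∀ w t → scale w t ≡ w * 2 ^ t
  scale≡ w zero    = sym (*-identityʳ w)
  scale≡ w (suc t) = trans (cong₂ _+_ (scale≡ w t) (scale≡ w t)) (trans (sym (*-distribˡ-+ w (2 ^ t) (2 ^ t))) (cong (w *_) (2^i+2^i t)))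

  n<2^n : ∀ n → n < 2 ^ n
  n<2^n zero    = s≤s z≤n
  n<2^n (suc n) = subst (suc n <_) (2^i+2^i n) (+-mono-≤-< (m^n>0 2 n) (n<2^n n))

  -- Length of the sieving interval.

  module _ (w : ℕ) (40≤w : 40 ≤ w) where

    open Sieve w 40≤w

    sizeExp-bound : ∀ t j → 4 * sizeExp t j ≤ 4 * 2 ^ w + rate j * K t
    sizeExp-bound zero    j = m≤m+n _ _
    sizeExp-bound (suc t) j = begin
      4 * ((k + k) * depth j + sizeExp t (suc j))                  ≡⟨ ident₁ k (depth j) (sizeExp t (suc j)) ⟩
      8 * depth j * k + 4 * sizeExp t (suc j)                      ≤⟨ +-monoʳ-≤ (8 * depth j * k) (sizeExp-bound t (suc j)) ⟩
      8 * depth j * k + (4 * 2 ^ w + rate (suc j) * k)        ≡⟨ ident₂ (8 * depth j) k (4 * 2 ^ w) (rate (suc j)) ⟩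
      4 * 2 ^ w + (8 * depth j + rate (suc j)) * k            ≡⟨ cong (λ z → 4 * 2 ^ w + z * k) (rate-step j) ⟩
      4 * 2 ^ w + 2 * rate j * k                              ≡⟨ cong (4 * 2 ^ w +_) (ident₃ (rate j) k) ⟩
      4 * 2 ^ w + rate j * (k + k)                            ∎
      where
        open ≤-Reasoning
        k = K t
        ident₁ : ∀ k b e → 4 * ((k + k) * b + e) ≡ 8 * b * k + 4 * e
        ident₁ = solve-∀
        ident₂ : ∀ b k c r → b * k + (c + r * k) ≡ c + (b + r) * k
        ident₂ = solve-∀
        ident₃ : ∀ r k → 2 * r * k ≡ r * (k + k)
        ident₃ = solve-∀

    -- The monomials account for (2 · 33 + 8) K = 74 K. Of the rest, the base primes contribute 8 ·
    -- 2^w; thanks to w ≤ t everything is at most 104 · 2^t, which one further K = w · 2^t covers.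
    exponent-bound : ∀ t → 128 ≤ w → w ≤ t → 8 * exponent t + 8 ≤ 75 * K t
    exponent-bound t 128≤w w≤t = begin
      8 * (6 + (sizeExp t 0 + suc (K t) + (w + 3 * t))) + 8        ≡⟨ ident₁ (sizeExp t 0) (K t) w t ⟩
      2 * (4 * sizeExp t 0) + 8 * K t + (64 + 8 * w + 24 * t)      ≤⟨ +-mono-≤ (+-monoˡ-≤ (8 * K t) (*-monoʳ-≤ 2 (sizeExp-bound t 0))) (+-mono-≤ (+-monoʳ-≤ 64 (*-monoʳ-≤ 8 w≤t)) (≤-refl {24 * t})) ⟩
      2 * (4 * 2 ^ w + 33 * K t) + 8 * K t + (64 + 8 * t + 24 * t) ≡⟨ ident₂ (2 ^ w) (K t) t ⟩
      74 * K t + (8 * 2 ^ w + (64 + 32 * t))                  ≤⟨ +-monoʳ-≤ (74 * K t) (+-mono-≤ (*-monoʳ-≤ 8 (^-monoʳ-≤ 2 w≤t)) (+-mono-≤ (*-monoʳ-≤ 64 (m^n>0 2 t)) (*-monoʳ-≤ 32 (<⇒≤ (n<2^n t))))) ⟩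
      74 * K t + (8 * 2 ^ t + (64 * 2 ^ t + 32 * 2 ^ t))      ≡⟨ cong (74 * K t +_) (ident₃ (2 ^ t)) ⟩
      74 * K t + 104 * 2 ^ t                                  ≤⟨ +-monoʳ-≤ (74 * K t) (≤-trans (*-monoˡ-≤ (2 ^ t) (≤-trans (m≤m+n 104 24) 128≤w)) (≤-reflexive (sym (scale≡ w t)))) ⟩
      74 * K t + K t                                          ≡⟨ +-comm (74 * K t) (K t) ⟩
      75 * K t                                                ∎
      where
        open ≤-Reasoning
        ident₁ : ∀ e k w t → 8 * (6 + (e + suc k + (w + 3 * t))) + 8 ≡ 2 * (4 * e) + 8 * k + (64 + 8 * w + 24 * t)
        ident₁ = solve-∀
        ident₂ : ∀ W k t → 2 * (4 * W + 33 * k) + 8 * k + (64 + 8 * t + 24 * t) ≡ 74 * k + (8 * W + (64 + 32 * t))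
        ident₂ = solve-∀
        ident₃ : ∀ x → 8 * x + (64 * x + 32 * x) ≡ 104 * x
        ident₃ = solve-∀

  -- Choice of the dyadic parameters.

  floor-log : ∀ n → 1 ≤ n → ∃[ L ] 2 ^ L ≤ n × n < 2 ^ suc L
  floor-log (suc zero)    _ = 0 , ≤-refl , s≤s (s≤s z≤n)
  floor-log (suc n@(suc _)) _ with floor-log n (s≤s z≤n)
  ... | L , lo , hi with suc n <? 2 ^ suc L
  ...   | yes lt = L , m≤n⇒m≤1+n lo , lt
  ...   | no ¬lt = suc L , ≮⇒≥ ¬lt , ≤-<-trans hi (^-monoʳ-< 2 (s≤s (s≤s z≤n)) {suc L} {suc (suc L)} ≤-refl)

  -- Sieving ranges come only as w · 2^t, and w must stay bounded to keep the base sieve constant.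
  -- Retaining the eight leading binary digits of M changes it by less than one part in 128.
  leading-bits : ∀ M → 128 ≤ M → ∃[ w ] ∃[ t ] 128 ≤ w × w < 256 × scale w t ≤ M × M < scale w t + 2 ^ t
  leading-bits = <-rec _ λ { M rec 128≤M → step M rec 128≤M }
    where
      Claim : ℕ → Set
      Claim M = 128 ≤ M → ∃[ w ] ∃[ t ] 128 ≤ w × w < 256 × scale w t ≤ M × M < scale w t + 2 ^ t
      step : ∀ M → (∀ {h} → h < M → Claim h) → Claim M
      step M rec 128≤M with M <? 256
      ... | yes M<256 = M , 0 , 128≤M , M<256 , ≤-refl , m<m+n M (s≤s z≤n)
      ... | no  M≮256 =
        let w , t , lo , hi , below , above = rec h<M 128≤h in
        w , suc t , lo , hi
        , (≤-trans (+-mono-≤ below (≤-trans below (⌊n/2⌋≤⌈n/2⌉ M))) (≤-reflexive (⌊n/2⌋+⌈n/2⌉≡n M)))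
        , (begin-strict
            M                                                    ≡⟨ sym (⌊n/2⌋+⌈n/2⌉≡n M) ⟩
            h + ⌈ M /2⌉                                          ≤⟨ +-monoʳ-≤ h (⌊n/2⌋-mono (n≤1+n (suc M))) ⟩
            h + suc h                                            <⟨ +-mono-<-≤ above above ⟩
            (scale w t + 2 ^ t) + (scale w t + 2 ^ t)            ≡⟨ ident (scale w t) (2 ^ t) ⟩
            scale w (suc t) + 2 ^ suc t                          ∎)
        where
          open ≤-Reasoning
          h = ⌊ M /2⌋
          h<M : h < M
          h<M = ⌊n/2⌋<n′ M 128≤M
            where
              ⌊n/2⌋<n′ : ∀ n → 128 ≤ n → ⌊ n /2⌋ < n
              ⌊n/2⌋<n′ (suc n) _ = ⌊n/2⌋<n n
          128≤h : 128 ≤ h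
          128≤h = ⌊n/2⌋-mono (≮⇒≥ M≮256)
          ident : ∀ s p → (s + p) + (s + p) ≡ s + s + 2 * p
          ident = solve-∀

  pow-compare : ∀ p q {e f N n} → 2 ^ e ≤ N → n ≤ 2 ^ f → f * q ≤ e * p → n ^ q ≤ N ^ p
  pow-compare p q {e} {f} {N} {n} e≤ ≤f le = begin
    n ^ q         ≤⟨ ^-monoˡ-≤ q ≤f ⟩
    (2 ^ f) ^ q   ≡⟨ ^-*-assoc 2 f q ⟩
    2 ^ (f * q)   ≤⟨ ^-monoʳ-≤ 2 le ⟩
    2 ^ (e * p)   ≡⟨ sym (^-*-assoc 2 e p) ⟩
    (2 ^ e) ^ p   ≤⟨ ^-monoˡ-≤ p e≤ ⟩
    N ^ p         ∎
    where open ≤-Reasoning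

  -- Arcs have length 2^(L + 1): half for the offsets φ, half for 4 A² (k + 1) with A = 2^K, which
  -- is the hypothesis on y. Roughness up to 2^(2 + K) covers all slopes, the largest being 2 A =
  -- 2^(K + 1).
  rough⇒code : ∀ {n} K L y → 2 ^ (5 + (K + L)) ≤ n → 2 + (K + K) + y ≤ L →
               -- Starting from n + 1 makes n the last element of the interval, so m ≤ n and k + 1 ≤
               -- 2^y.
               (∃[ m ] suc n ∸ 2 ^ y ≤ m × m < 2 ^ y + (suc n ∸ 2 ^ y) × AvoidsBelow (2 ^ (2 + K)) m) →
               M≥ n (n ∸ 1) (2 ^ K * (2 ^ K * 2 ^ L))
  rough⇒code {n} K L y 2^≤n room (m , m≥ , m< , avoids) =
    subst (λ z → M≥ z (z ∸ 1) (2 ^ K * (2 ^ K * 2 ^ L))) m+k≡n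
      (Construction.code m k A Φ (2 ^ suc L) {{>-nonZero 1≤m}} (m^n>0 2 K) l-large m-large
        (λ {d} {g} 1≤d d≤ m∣dg → coprime-divisor (avoids⇒coprime avoids 1≤d (≤-<-trans d≤ 2A<)) m∣dg)
        (≤-trans 2≤n (≤-reflexive (sym m+k≡n))))
    where
      open ≤-Reasoning
      A = 2 ^ K
      Φ = 2 ^ L
      k = n ∸ m
      y≤L : y ≤ L
      y≤L = ≤-trans (m≤n+m y (2 + (K + K))) room
      2^y≤n : 2 ^ y ≤ n
      2^y≤n = ≤-trans (^-monoʳ-≤ 2 (≤-trans y≤L (≤-trans (m≤n+m L K) (m≤n+m (K + L) 5)))) 2^≤n
      2^y≤1+n : 2 ^ y ≤ suc n
      2^y≤1+n = m≤n⇒m≤1+n 2^y≤n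
      m≤n : m ≤ n
      m≤n = s≤s⁻¹ (subst (m <_) (m+[n∸m]≡n 2^y≤1+n) m<)
      m+k≡n : m + k ≡ n
      m+k≡n = m+[n∸m]≡n m≤n
      1+k≤2^y : suc k ≤ 2 ^ y
      1+k≤2^y = begin
        suc (n ∸ m)                          ≡⟨ sym (+-∸-assoc 1 m≤n) ⟩
        suc n ∸ m                            ≤⟨ ∸-monoʳ-≤ (suc n) m≥ ⟩
        suc n ∸ (suc n ∸ 2 ^ y)              ≡⟨ m∸[m∸n]≡n 2^y≤1+n ⟩
        2 ^ y                                ∎
      2A< : A + A < 2 ^ (2 + K)
      2A< = ≤-<-trans (≤-reflexive (2^i+2^i K)) (^-monoʳ-< 2 (s≤s (s≤s z≤n)) {suc K} {suc (suc K)} ≤-refl)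
      l-large : Φ + 4 * (A * A * suc k) ≤ 2 ^ suc L
      l-large = begin
        Φ + 4 * (A * A * suc k)              ≤⟨ +-monoʳ-≤ Φ (*-monoʳ-≤ 4 (*-monoʳ-≤ (A * A) 1+k≤2^y)) ⟩
        Φ + 4 * (A * A * 2 ^ y)              ≡⟨ cong (λ z → Φ + 4 * (z * 2 ^ y)) (sym (^-distribˡ-+-* 2 K K)) ⟩
        Φ + 4 * (2 ^ (K + K) * 2 ^ y)        ≡⟨ cong (λ z → Φ + 4 * z) (sym (^-distribˡ-+-* 2 (K + K) y)) ⟩
        Φ + 4 * 2 ^ (K + K + y)              ≡⟨ cong (Φ +_) (*-assoc 2 2 (2 ^ (K + K + y))) ⟩
        Φ + 2 ^ (2 + (K + K) + y)            ≤⟨ +-monoʳ-≤ Φ (^-monoʳ-≤ 2 room) ⟩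
        Φ + Φ                                ≡⟨ 2^i+2^i L ⟩
        2 ^ suc L                            ∎
      P = 2 ^ (3 + (K + L))
      m-large : suc (A + A) * 2 ^ suc L ≤ m
      m-large = begin
        suc (A + A) * 2 ^ suc L              ≤⟨ *-monoˡ-≤ (2 ^ suc L) 2A< ⟩
        2 ^ (2 + K) * 2 ^ suc L              ≡⟨ sym (^-distribˡ-+-* 2 (2 + K) (suc L)) ⟩
        2 ^ (2 + K + suc L)                  ≡⟨ cong (2 ^_) (ident K L) ⟩
        P                                    ≤⟨ m+n≤o⇒m≤o∸n P (≤-trans (+-monoʳ-≤ P (^-monoʳ-≤ 2 {y} {3 + (K + L)} (≤-trans y≤L (≤-trans (m≤n+m L K) (m≤n+m (K + L) 3)))))
                                                  (≤-trans (≤-reflexive (2^i+2^i (3 + (K + L)))) (≤-trans (^-monoʳ-≤ 2 (n≤1+n (4 + (K + L)))) (m≤n⇒m≤1+n 2^≤n)))) ⟩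
        suc n ∸ 2 ^ y                        ≤⟨ m≥ ⟩
        m                                    ∎
        where ident : ∀ K L → 2 + K + suc L ≡ 3 + (K + L)
              ident = solve-∀
      1≤m : 1 ≤ m
      1≤m = ≤-trans (*-mono-≤ (s≤s {0} {A + A} z≤n) (m^n>0 2 (suc L))) m-large
      2≤n : 2 ≤ n
      2≤n = ≤-trans (^-monoʳ-≤ 2 {1} {5 + (K + L)} (s≤s z≤n)) 2^≤n

  -- Numerical balance of the exponents.

  room-for-sieve : ∀ {K L M y} → 99 * M ≤ 8 * L → K ≤ M → 8 * y + 8 ≤ 75 * K → 1 + 3 * K + y ≤ L
  room-for-sieve {K} {L} {M} {y} 99M≤8L K≤M y≤ = *-cancelˡ-≤ 8 (begin
    8 * (1 + 3 * K + y)       ≡⟨ ident K y ⟩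
    (8 * y + 8) + 24 * K      ≤⟨ +-monoˡ-≤ (24 * K) y≤ ⟩
    75 * K + 24 * K           ≡⟨ sym (*-distribʳ-+ K 75 24) ⟩
    99 * K                    ≤⟨ *-monoʳ-≤ 99 K≤M ⟩
    99 * M                    ≤⟨ 99M≤8L ⟩
    8 * L                     ∎)
    where
      open ≤-Reasoning
      ident : ∀ K y → 8 * (1 + 3 * K + y) ≡ (8 * y + 8) + 24 * K
      ident = solve-∀

  -- Uses 797 · 25/2 < 10000.
  exponent-gain : ∀ {K L} → 1622 ≤ K → 2 * (5 + (K + L)) ≤ 25 * K → suc (5 + (K + L)) * 10797 ≤ (K + (K + L)) * 10000
  exponent-gain {K} {L} 1622≤K le = +-cancelʳ-≤ 50000 _ _ (begin
    suc Λ * 10797 + 50000                 ≡⟨ ident₁ 10000 797 50000 Λ ⟩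
    (797 * Λ + 60797) + 10000 * Λ         ≤⟨ +-monoˡ-≤ (10000 * Λ) gain ⟩
    10000 * K + 10000 * Λ                 ≡⟨ ident₂ 10000 K L ⟩
    (K + (K + L)) * 10000 + 5 * 10000     ∎)
    where
      open ≤-Reasoning
      Λ = 5 + (K + L)
      ident₁ : ∀ a c d Λ → suc Λ * (a + c) + d ≡ (c * Λ + (a + c + d)) + a * Λ
      ident₁ = solve-∀
      ident₂ : ∀ a K L → a * K + a * (5 + (K + L)) ≡ (K + (K + L)) * a + 5 * a
      ident₂ = solve-∀
      ident₃ : ∀ c d Λ → 2 * (c * Λ + d) ≡ c * (2 * Λ) + 2 * d
      ident₃ = solve-∀
      gain : 797 * Λ + 60797 ≤ 10000 * K
      gain = *-cancelˡ-≤ 2 (begin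
        2 * (797 * Λ + 60797)          ≡⟨ ident₃ 797 60797 Λ ⟩
        -- 1622 is the least K with 2 · 60797 ≤ 75 K, where 75 = 20000 - 797 · 25.
        797 * (2 * Λ) + 2 * 60797      ≤⟨ +-mono-≤ (*-monoʳ-≤ 797 le) (≤-trans (m≤m+n 121594 56) (*-monoʳ-≤ 75 1622≤K)) ⟩
        797 * (25 * K) + 75 * K        ≡⟨ cong (_+ 75 * K) (sym (*-assoc 797 25 K)) ⟩
        19925 * K + 75 * K             ≡⟨ sym (*-distribʳ-+ K 19925 75) ⟩
        20000 * K                      ≡⟨ *-assoc 2 10000 K ⟩
        2 * (10000 * K)                ∎)

  -- 99/8 · 129/128 stays below 25/2: 99 · 129 = 12771 falls short of 12800 by 29, and this margin
  -- absorbs the additive constants once K is large.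
  log-ratio : ∀ {K L M P} → 8 * L < 99 * suc M → 128 * P ≤ 2 + K → M < 2 + K + P → 1622 ≤ K → 2 * L ≤ 25 * K
  log-ratio {K} {L} {M} {P} 8L< P≤ M< 1622≤K = *-cancelˡ-≤ 512 (begin
    512 * (2 * L)                          ≡⟨ trans (sym (*-assoc 512 2 L)) (*-assoc 128 8 L) ⟩
    128 * (8 * L)                          ≤⟨ *-monoʳ-≤ 128 (<⇒≤ 8L<) ⟩
    128 * (99 * suc M)                     ≤⟨ *-monoʳ-≤ 128 (*-monoʳ-≤ 99 M<) ⟩
    128 * (99 * (2 + K + P))               ≡⟨ ident₁ 128 99 (2 + K) P ⟩
    99 * (128 * (2 + K) + 128 * P)         ≤⟨ *-monoʳ-≤ 99 (+-monoʳ-≤ (128 * (2 + K)) P≤) ⟩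
    99 * (128 * (2 + K) + (2 + K))         ≡⟨ ident₂ 99 128 K ⟩
    99 * 129 * K + 99 * (2 * 129)          ≤⟨ +-monoʳ-≤ (99 * 129 * K) (≤-trans (m≤m+n 25542 21496) (*-monoʳ-≤ 29 1622≤K)) ⟩
    99 * 129 * K + 29 * K                  ≡⟨ sym (*-distribʳ-+ K 12771 29) ⟩
    12800 * K                              ≡⟨ *-assoc 512 25 K ⟩
    512 * (25 * K)                         ∎)
    where
      open ≤-Reasoning
      ident₁ : ∀ a c K P → a * (c * (K + P)) ≡ c * (a * K + a * P)
      ident₁ = solve-∀
      ident₂ : ∀ c a K → c * (a * (2 + K) + (2 + K)) ≡ c * suc a * K + c * (2 * suc a)
      ident₂ = solve-∀

  -- With the code size a power of two and n below a power of two, the real exponent becomes a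
  -- comparison of two integers.
  Bound : ℕ → Set
  Bound n = ∃[ e ] ∃[ f ] M≥ n (n ∸ 1) (2 ^ e) × n ≤ 2 ^ f × f * 10797 ≤ e * 10000

  module _ {s n L M w t : ℕ} (256≤s : 256 ≤ s) (B≤M : 2 ^ (8 + s) ≤ M) (99M≤8L : 99 * M ≤ 8 * L) (8L< : 8 * L < 99 * suc M)
           (2^L≤n : 2 ^ L ≤ n) (n<2^1+L : n < 2 ^ suc L)
           (128≤w : 128 ≤ w) (w<256 : w < 256) (K≤M : scale w t ≤ M) (M< : M < scale w t + 2 ^ t) where

    bound-at-scale : Bound n
    bound-at-scale = K′ + (K′ + L′) , suc Λ ,
        subst (M≥ n (n ∸ 1)) (sym N≡) (rough⇒code K′ L′ y 2^≤n room rough) ,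
        <⇒≤ (subst (λ z → n < 2 ^ suc z) (sym Λ≡L) n<2^1+L) ,
        exponent-gain {K′} {L′} 1622≤K′ (subst (λ z → 2 * z ≤ 25 * K′) (sym Λ≡L)
          (log-ratio {K′} {L} {M} {P} 8L< (subst (128 * P ≤_) (sym K≡) 128P≤K) (subst (λ z → M < z + P) (sym K≡) M<) 1622≤K′))
      where
      open ≤-Reasoning
      40≤w = ≤-trans (m≤m+n 40 88) 128≤w
      open Sieve w 40≤w using (exponent; rough-in-interval)
      K = scale w t
      P = 2 ^ t
      128P≤K : 128 * P ≤ K
      128P≤K = ≤-trans (*-monoˡ-≤ P 128≤w) (≤-reflexive (sym (scale≡ w t)))
      -- w fills only eight bits, so a large M forces t to be large; t must exceed w for
      -- `exponent-bound`.
      s≤t : s ≤ t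
      s≤t = +-cancelˡ-≤ 8 s t (2^-cancel-≤ (begin
        2 ^ (8 + s)        ≤⟨ B≤M ⟩
        M                  ≤⟨ <⇒≤ M< ⟩
        K + P              ≡⟨ cong (_+ P) (scale≡ w t) ⟩
        w * P + P          ≡⟨ +-comm (w * P) P ⟩
        suc w * P          ≤⟨ *-monoˡ-≤ P w<256 ⟩
        256 * P            ≡⟨ sym (^-distribˡ-+-* 2 8 t) ⟩
        2 ^ (8 + t)        ∎))
      256≤t = ≤-trans 256≤s s≤t
      y = exponent t
      fits : 1 + 3 * K + y ≤ L
      fits = room-for-sieve {K} {L} {M} 99M≤8L K≤M (exponent-bound w 40≤w t 128≤w (≤-trans (<⇒≤ w<256) 256≤t))
      K-large : 1624 ≤ K
      K-large = ≤-trans (m≤m+n 1624 31144) (≤-trans (*-monoʳ-≤ 128 (≤-trans 256≤t (<⇒≤ (n<2^n t)))) 128P≤K)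
      -- The sieve clears primes below 2^K, while `rough⇒code` asks for 2^(2 + K′).
      K′ = K ∸ 2
      K≡ : 2 + K′ ≡ K
      K≡ = m+[n∸m]≡n (≤-trans (m≤m+n 2 1622) K-large)
      1622≤K′ : 1622 ≤ K′
      1622≤K′ = ∸-monoˡ-≤ 2 K-large
      fits′ : (5 + K′) + (2 + (K′ + K′) + y) ≤ L
      fits′ = ≤-trans (≤-reflexive (trans (ident K′ y) (cong (λ z → 1 + 3 * z + y) K≡))) fits
        where ident : ∀ K y → (5 + K) + (2 + (K + K) + y) ≡ 1 + 3 * (2 + K) + y
              ident = solve-∀
      L′ = L ∸ (5 + K′)
      room : 2 + (K′ + K′) + y ≤ L′
      room = m+n≤o⇒m≤o∸n _ (≤-trans (≤-reflexive (+-comm (2 + (K′ + K′) + y) (5 + K′))) fits′)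
      Λ = 5 + (K′ + L′)
      Λ≡L : Λ ≡ L
      Λ≡L = trans (sym (+-assoc 5 K′ L′)) (m+[n∸m]≡n (≤-trans (m≤m+n (5 + K′) _) fits′))
      N≡ : 2 ^ (K′ + (K′ + L′)) ≡ 2 ^ K′ * (2 ^ K′ * 2 ^ L′)
      N≡ = trans (^-distribˡ-+-* 2 K′ (K′ + L′)) (cong (2 ^ K′ *_) (^-distribˡ-+-* 2 K′ L′))
      2^≤n : 2 ^ Λ ≤ n
      2^≤n = subst (λ z → 2 ^ z ≤ n) (sym Λ≡L) 2^L≤n
      rough : ∃[ m ] suc n ∸ 2 ^ y ≤ m × m < 2 ^ y + (suc n ∸ 2 ^ y) × AvoidsBelow (2 ^ (2 + K′)) m
      rough = subst (λ z → ∃[ m ] suc n ∸ 2 ^ y ≤ m × m < 2 ^ y + (suc n ∸ 2 ^ y) × AvoidsBelow (2 ^ z) m) (sym K≡)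
                (rough-in-interval t (suc n ∸ 2 ^ y))

  2^-cancel-< : ∀ {a b} → 2 ^ a < 2 ^ b → a < b
  2^-cancel-< {a} {b} lt = ≰⇒> λ b≤a → <⇒≱ lt (^-monoʳ-≤ 2 b≤a)

  bound-at-log : ∀ {s n L} → 256 ≤ s → 13 * 2 ^ (8 + s) ≤ L → 2 ^ L ≤ n → n < 2 ^ suc L → Bound n
  bound-at-log {s} {n} {L} 256≤s 13B≤L 2^L≤n n<2^1+L =
    let w , t , 128≤w , w<256 , K≤M , M< = leading-bits M (≤-trans (^-monoʳ-≤ 2 {7} {8 + s} (m≤m+n 7 (1 + s))) B≤M)
    in bound-at-scale {s} {n} {L} {M} {w} {t} 256≤s B≤M 99M≤8L 8L< 2^L≤n n<2^1+L 128≤w w<256 K≤M M<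
    where
      open ≤-Reasoning
      B = 2 ^ (8 + s)
      M = (8 * L) / 99
      99M≤8L : 99 * M ≤ 8 * L
      99M≤8L = ≤-trans (≤-reflexive (*-comm 99 M)) (m/n*n≤m (8 * L) 99)
      8L< : 8 * L < 99 * suc M
      8L< = begin-strict
        8 * L                         ≡⟨ m≡m%n+[m/n]*n (8 * L) 99 ⟩
        (8 * L) % 99 + M * 99         <⟨ +-monoˡ-< (M * 99) (m%n<n (8 * L) 99) ⟩
        99 + M * 99                   ≡⟨ *-comm (suc M) 99 ⟩
        99 * suc M                    ∎
      B≤M : B ≤ M
      -- 13 is the least integer that is at least 99/8.
      B≤M = s≤s⁻¹ (*-cancelˡ-< 99 B (suc M) (≤-<-trans (begin
        99 * B           ≤⟨ *-monoˡ-≤ B (m≤m+n 99 5) ⟩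
        104 * B          ≡⟨ *-assoc 8 13 B ⟩
        8 * (13 * B)     ≤⟨ *-monoʳ-≤ 8 13B≤L ⟩
        8 * L            ∎) 8L<))

  large⇒bound : ∀ s → 256 ≤ s → ∀ n → 2 ^ (13 * 2 ^ (8 + s)) ≤ n → Bound n
  large⇒bound s 256≤s n n≥ =
    let L , lo , hi = floor-log n (≤-trans (m^n>0 2 (13 * 2 ^ (8 + s))) n≥)
    in bound-at-log {s} {n} {L} 256≤s (s≤s⁻¹ (2^-cancel-< {13 * 2 ^ (8 + s)} {suc L} (≤-<-trans n≥ hi))) lo hi

  bound⇒power : ∀ {n} → Bound n → Σ ℕ λ m → M≥ n (n ∸ 1) m × m ^ 10000 ≥ n ^ 10797
  bound⇒power {n} (e , f , code , n≤ , gain) = 2 ^ e , code , pow-compare 10000 10797 {e} {f} {2 ^ e} {n} ≤-refl n≤ gain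

  -- The threshold makes t ≥ s, and s ≥ 256 puts t above every admissible w.
  eventually : ∀ s → 256 ≤ s → Σ ℕ λ n₀ → (n : ℕ) → n ≥ n₀ → Σ ℕ λ m → M≥ n (n ∸ 1) m × m ^ 10000 ≥ n ^ 10797
  eventually s 256≤s = 2 ^ (13 * 2 ^ (8 + s)) , λ n n≥ → bound⇒power (large⇒bound s 256≤s n n≥)

theorem1p1 : Σ ℕ λ n₀ → (n : ℕ) → n ≥ n₀ →
    Σ ℕ λ m → M≥ n (n ∸ 1) m × m ^ 10000 ≥ n ^ 10797
theorem1p1 = Exponents.eventually 256 ℕ.≤-refl
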